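{- For any partition $P$ of a positive integer $n$, $\min(\lambda_U(P))=\mu(P)$.
   Context: Partitions and poset. Write a partition as $P=(p_s^{n_s},\dots,p_1^{n_1})$ with $p_s>\cdots>p_1\ge 1$ and $n_i\ge 1$, where $n_i$ is the multiplicity of the part $p_i$. The poset $\mathcal{D}_P$ has as elements the triples $(u,p_i,k)$ with $1\le i\le s$, $1\le u\le p_i$, $1\le k\le n_i$ (so $|\mathcal{D}_P|=n$ if $P\vdash n$). Its order is the partial order with the following covering relations: $(v,p_j,\ell)$ covers $(u,p_i,k)$ if and only if one of the following holds: ($\alpha$) $j=i+1$, $v=u+p_{i+1}-p_i$, $\ell=1$, $k=n_i$; ($\beta$) $j=i-1$, $v=u$, $\ell=1$, $k=n_i$; ($e$) $j=i$, $v=u$, $\ell=k+1$; ($\omega$) $j=i$, neither $p_i+1$ nor $p_i-1$ is a part of $P$, $v=u+1$, $\ell=1$, $k=n_i$. $U$-chains and $\lambda_U(P)$. For a positive integer $m$ and a set $A=\{a_1,a_1+1,\dots,a_m,a_m+1\}\subset\mathbb{N}$ with $a_1<a_1+1<a_2<a_2+1<\cdots<a_m<a_m+1$, the $m$-$U$-chain is $U_A=\bigcup_{i=1}^m S_{A;i}$, where $$S_{A;i}=\{(u,p,k)\in\mathcal{D}_P : p\in\{a_i,a_i+1\},\ i\le u\le p-i+1\}\cup\{(u,p,k)\in\mathcal{D}_P : p>a_i+1,\ u\in\{i,p-i+1\}\}.$$ Let $u_0=0$ and, for $k\ge1$, let $u_k$ be the maximum cardinality of a $k$-$U$-chain in $\mathcal{D}_P$.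 Then $\lambda_U(P)=(\lambda_{U,1},\lambda_{U,2},\dots)$ with $\lambda_{U,k}=u_k-u_{k-1}$. It has exactly $r(P)$ (nonzero) parts (with $r(P)$ defined below), and $\min(\lambda_U(P))=\lambda_{U,r(P)}$. The number $r(P)$. A partition is almost rectangular if its largest and smallest parts differ by at most $1$. $r(P)$ is the minimum number of almost rectangular subpartitions in a decomposition of $P$ as a union (multiset union of parts) of almost rectangular subpartitions. The invariant $\mu(P)$. An $s$-spread (or spread) is a partition $P=(p_s^{n_s},\dots,p_1^{n_1})$ with $p_1>0$, $p_{i+1}=p_i+1$ for $1\le i<s$, and $n_i>0$ for all $i$; then $r(P)=\lceil s/2\rceil$. For an $s$-spread with smallest part $p=p_1$, put $n_{s+1}=0$ and $\mu(P)=\min\{p\,n_{2i-1}+(p+1)\,n_{2j} : 1\le i\le j\le r(P)\}$. For an arbitrary partition write $P=P_\ell\cup\cdots\cup P_1$ where each $P_k$ is a spread and the largest part of $P_k$ is at most the smallest part of $P_{k+1}$ minus $2$. With $\bar r_k=\sum_{i=1}^{k-1} r(P_i)$, define $\mu(P)=\min\{\mu(P_k-2\bar r_k): 1\le k\le \ell\}$, where $P-c$ denotes the partition obtained from $P$ by subtracting $c$ from each part. -}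

module Defs where

open import Data.Bool using (if_then_else_)
open import Data.Fin using (Fin; zero; suc; toℕ)
open import Data.Fin.Properties using (any?)
open import Data.List using (List; []; _∷_; map; concatMap; replicate; filter; length; upTo; cartesianProduct)
import Data.List.Extrema.Nat as Extrema
open import Data.List.Membership.Propositional using (_∈_)
open import Data.List.Membership.Propositional.Properties using (∈-upTo⁺; ∈-filter⁺; ∈-cartesianProduct⁺; ∈-map⁺)
open import Data.List.NonEmpty as List⁺ using (List⁺; _∷_; [_]; _∷⁺_; toList)
open import Data.List.Relation.Unary.All as All using (All; all?; []; _∷_)
open import Data.List.Relation.Unary.All.Properties using (all-filter)
open import Data.List.Relation.Unary.Any using (here)
open import Data.List.Relation.Unary.Linked using (Linked)
open import Data.Nat using (ℕ; zero; suc; pred; _+_; _*_; _∸_; _≤_; _<_; _⊓_; _≡ᵇ_; _≟_; _≤?_; _<?_; s≤s)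
open import Data.Nat.ListAction using (sum)
open import Data.Nat.Properties
open import Data.Product using (_×_; _,_; ∃; ∃-syntax; proj₁; proj₂; uncurry)
open import Data.Sum using (_⊎_; inj₁; inj₂)
open import Data.Vec using (Vec; []; _∷_; lookup)
open import Data.Vec.Relation.Unary.All as VAll using ([]; _∷_)
open import Data.Vec.Relation.Unary.Linked as VLinked using ([]; [-]; _∷_)
open import Function using (_∘_)
open import Relation.Binary.PropositionalEquality using (_≡_; refl; sym; trans; cong; subst)
open import Relation.Nullary using (yes; no; contradiction)
open import Relation.Nullary.Decidable using (_×-dec_; _⊎-dec_)
open import Relation.Unary using (Pred; Decidable)
open import Level using (0ℓ)

IsMinimum : Pred ℕ 0ℓ → ℕ → Set
IsMinimum S m = S m × (∀ x → S x → m ≤ x)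

IsMaximum : Pred ℕ 0ℓ → ℕ → Set
IsMaximum S m = S m × (∀ x → S x → x ≤ m)

-- Every list this is applied to below is nonempty (for a nonempty partition).
minimum : List ℕ → ℕ
minimum []       = 0
minimum (x ∷ xs) = Extrema.min x xs

-- 1, 2, …, n
[1⋯_] : ℕ → List ℕ
[1⋯ n ] = map suc (upTo n)

------------------------------------------------------------------------
-- Partitions

-- A block (p , n) is the part p with multiplicity n.
Block : Set
Block = ℕ × ℕ

-- The blocks (p₁ , n₁), …, (pₛ , nₛ) are listed from the smallest part p₁
-- up, so that list positions agree with the subscripts.
record Partition : Set where
  field
    blocks     : List Block
    increasing : Linked (λ b c → proj₁ b < proj₁ c) blocks
    positive   : All (λ b → 1 ≤ proj₁ b × 1 ≤ proj₂ b) blocks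

open Partition public

_⊢_ : Partition → ℕ → Set
P ⊢ n = sum (map (uncurry _*_) (blocks P)) ≡ n

parts : List Block → List ℕ
parts = concatMap (λ (p , n) → replicate n p)

------------------------------------------------------------------------
-- The underlying set of 𝒟_P and its U-chains
--
-- U-chains are given by explicit sets of elements, so the order of 𝒟_P
-- plays no role here.

Triple : Set
Triple = ℕ × ℕ × ℕ

-- Without repetitions, as the parts of distinct blocks differ.
𝒟 : Partition → List Triple
𝒟 P = concatMap
  (λ (p , n) → map (λ (u , k) → u , p , k) (cartesianProduct [1⋯ p ] [1⋯ n ]))
  (blocks P)

-- A = {a₁ , a₁+1 , … , aₘ , aₘ+1} is given by the vector of the aᵢ.
IsIndexSet : ∀ {m} → Vec ℕ m → Set
IsIndexSet = VLinked.Linked (λ a b → suc a < b)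

-- S a i is S_{A;i} for a = aᵢ.  Since i ≥ 1 and aᵢ ≥ 2 (i - 1), we have
-- i ≤ p + 1 whenever p ≥ aᵢ, so suc p ∸ i is p - i + 1 without truncation.
S : ℕ → ℕ → Pred Triple 0ℓ
S a i (u , p , k) =
    ((p ≡ a ⊎ p ≡ suc a) × (i ≤ u × u ≤ suc p ∸ i))
  ⊎ (suc a < p × (u ≡ i ⊎ u ≡ suc p ∸ i))

S? : ∀ a i → Decidable (S a i)
S? a i (u , p , k) =
    ((p ≟ a ⊎-dec p ≟ suc a) ×-dec (i ≤? u ×-dec u ≤? suc p ∸ i))
  ⊎-dec (suc a <? p ×-dec (u ≟ i ⊎-dec u ≟ suc p ∸ i))

-- Fin counts from 0, hence the shift of the index i.
U : ∀ {m} → Vec ℕ m → Pred Triple 0ℓ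
U A t = ∃[ i ] S (lookup A i) (suc (toℕ i)) t

U? : ∀ {m} (A : Vec ℕ m) → Decidable (U A)
U? A t = any? (λ i → S? (lookup A i) (suc (toℕ i)) t)

∣U∣ : ∀ {m} → Partition → Vec ℕ m → ℕ
∣U∣ P A = length (filter (U? A) (𝒟 P))

UChainCardinality : Partition → ℕ → Pred ℕ 0ℓ
UChainCardinality P m c = ∃[ A ] IsIndexSet {m} A × ∣U∣ P A ≡ c

-- The cardinalities of m-U-chains have a maximum: entries aᵢ exceeding the
-- largest part may be lowered without changing the chain, as long as they
-- stay above that part, so finitely many A suffice.
private
  largestPart : Partition → ℕ
  largestPart P = Extrema.max 0 (map (proj₁ ∘ proj₂) (𝒟 P))

  clip : ∀ {m} → ℕ → Vec ℕ m → Vec ℕ m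
  clip B []      = []
  clip B (a ∷ A) = a ⊓ B ∷ clip (2 + B) A

  clip-index : ∀ {m} B {A : Vec ℕ m} → IsIndexSet A → IsIndexSet (clip B A)
  clip-index B []          = []
  clip-index B [-]         = [-]
  clip-index B {a ∷ b ∷ A} (a<b ∷ L) =
    ⊓-glb (≤-trans (s≤s (s≤s (m⊓n≤m a B))) a<b) (s≤s (s≤s (m⊓n≤n a B)))
    ∷ clip-index (2 + B) L

  clip-bound : ∀ {m} B (A : Vec ℕ m) → VAll.All (_< suc (B + 2 * m)) (clip B A)
  clip-bound B [] = []
  clip-bound {suc m} B (a ∷ A) =
      s≤s (≤-trans (m⊓n≤n a B) (m≤m+n B (2 * suc m)))
    ∷ VAll.map (λ q → ≤-trans q (s≤s (≤-reflexive eq))) (clip-bound (2 + B) A)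
    where
    eq : 2 + B + 2 * m ≡ B + 2 * suc m
    eq = trans (cong (_+ 2 * m) (+-comm 2 B))
        (trans (+-assoc B 2 (2 * m)) (cong (B +_) (sym (*-suc 2 m))))

  clip-lookup : ∀ {m} M B → M < B → (A : Vec ℕ m) → ∀ i →
    lookup (clip B A) i ≡ lookup A i
    ⊎ (M < lookup (clip B A) i × M < lookup A i)
  clip-lookup M B M<B (a ∷ A) zero with a ≤? B
  ... | yes a≤B = inj₁ (m≤n⇒m⊓n≡m a≤B)
  ... | no  a≰B = inj₂ (subst (M <_) (sym (m≥n⇒m⊓n≡n (<⇒≤ (≰⇒> a≰B)))) M<B
                       , <-trans M<B (≰⇒> a≰B))
  clip-lookup M B M<B (a ∷ A) (suc i) =
    clip-lookup M (2 + B) (≤-trans M<B (m≤n+m B 2)) A i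

  above : ∀ a i u p k {X : Set} → p < a → S a i (u , p , k) → X
  above _ _ _ _ _ p<a (inj₁ (inj₁ refl , _)) = contradiction p<a (<-irrefl refl)
  above _ _ _ _ _ p<a (inj₁ (inj₂ refl , _)) = contradiction (<⇒≤ p<a) (<-irrefl refl)
  above _ _ _ _ _ p<a (inj₂ (a<p , _)) = contradiction (<-trans p<a (<⇒≤ a<p)) (<-irrefl refl)

  clip-U : ∀ {m} M B → M < B → (A : Vec ℕ m) → ∀ u p k → p ≤ M →
    (U (clip B A) (u , p , k) → U A (u , p , k))
    × (U A (u , p , k) → U (clip B A) (u , p , k))
  clip-U {m} M B M<B A u p k p≤M = to , from
    where
    to : U (clip B A) (u , p , k) → U A (u , p , k)
    to (i , s) with clip-lookup M B M<B A i
    ... | inj₁ eq      = i , subst (λ a → S a (suc (toℕ i)) (u , p , k)) eq s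
    ... | inj₂ (l , _) = above _ (suc (toℕ i)) u p k (≤-<-trans p≤M l) s
    from : U A (u , p , k) → U (clip B A) (u , p , k)
    from (i , s) with clip-lookup M B M<B A i
    ... | inj₁ eq      = i , subst (λ a → S a (suc (toℕ i)) (u , p , k)) (sym eq) s
    ... | inj₂ (_ , l) = above _ (suc (toℕ i)) u p k (≤-<-trans p≤M l) s

  length-filter : ∀ {Q R : Pred Triple 0ℓ} (Q? : Decidable Q) (R? : Decidable R) ts →
    All (λ t → (Q t → R t) × (R t → Q t)) ts →
    length (filter Q? ts) ≡ length (filter R? ts)
  length-filter Q? R? [] [] = refl
  length-filter Q? R? (t ∷ ts) ((f , g) ∷ h) with Q? t | R? t
  ... | yes _ | yes _ = cong suc (length-filter Q? R? ts h)
  ... | no _  | no _  = length-filter Q? R? ts h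
  ... | yes q | no ¬r = contradiction (f q) ¬r
  ... | no ¬q | yes r = contradiction (g r) ¬q

  clip-card : ∀ {m} P (A : Vec ℕ m) → ∣U∣ P (clip (suc (largestPart P)) A) ≡ ∣U∣ P A
  clip-card P A = length-filter (U? (clip (suc (largestPart P)) A)) (U? A) (𝒟 P)
    (All.tabulate λ {(u , p , k)} t∈ →
      clip-U (largestPart P) (suc (largestPart P)) ≤-refl A u p k
        (All.lookup (Extrema.xs≤max 0 (map (proj₁ ∘ proj₂) (𝒟 P)))
          (∈-map⁺ (proj₁ ∘ proj₂) t∈)))

  vecs : ∀ m → ℕ → List (Vec ℕ m)
  vecs zero    B = [] ∷ []
  vecs (suc m) B = map (uncurry _∷_) (cartesianProduct (upTo B) (vecs m B))

  ∈-vecs : ∀ {m B} {A : Vec ℕ m} → VAll.All (_< B) A → A ∈ vecs m B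
  ∈-vecs []      = here refl
  ∈-vecs (l ∷ h) = ∈-map⁺ (uncurry _∷_) (∈-cartesianProduct⁺ (∈-upTo⁺ l) (∈-vecs h))

  spaced : ∀ m → ℕ → Vec ℕ m
  spaced zero    a = []
  spaced (suc m) a = a ∷ spaced m (2 + a)

  spaced-index : ∀ m a → IsIndexSet (spaced m a)
  spaced-index zero          a = []
  spaced-index (suc zero)    a = [-]
  spaced-index (suc (suc m)) a = ≤-refl ∷ spaced-index (suc m) (2 + a)

abstract
  u-max : ∀ P m → ∃ (IsMaximum (UChainCardinality P m))
  u-max P m = ∣U∣ P best , (best , best-index , refl) , bound
    where
    index? : Decidable (IsIndexSet {m})
    index? = VLinked.linked? (λ a b → suc a <? b)
    B : ℕ
    B = suc (largestPart P)
    candidates : List (Vec ℕ m)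
    candidates = filter index? (vecs m (suc (B + 2 * m)))
    best : Vec ℕ m
    best = Extrema.argmax (∣U∣ P) (spaced m 0) candidates
    best-index : IsIndexSet best
    best-index = Extrema.argmax-all (∣U∣ P) (spaced-index m 0) (all-filter index? (vecs m (suc (B + 2 * m))))
    bound : ∀ x → UChainCardinality P m x → x ≤ ∣U∣ P best
    bound _ (A , L , refl) = subst (_≤ ∣U∣ P best) (clip-card P A)
      (All.lookup (Extrema.f[xs]≤f[argmax] {f = ∣U∣ P} (spaced m 0) candidates)
        (∈-filter⁺ index? (∈-vecs (clip-bound B A)) (clip-index B L)))

u : Partition → ℕ → ℕ
u P zero    = 0
u P (suc k) = proj₁ (u-max P (suc k))

-- λ_{U,k} for k ≥ 1.  The difference is not truncated: appending an entry
-- beyond the largest part turns a (k-1)-U-chain into an equal k-U-chain.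
λU : Partition → ℕ → ℕ
λU P k = u P k ∸ u P (pred k)

PartOfλU : Partition → Pred ℕ 0ℓ
PartOfλU P x = 1 ≤ x × ∃[ k ] 1 ≤ k × λU P k ≡ x

------------------------------------------------------------------------
-- The number r(P)

AlmostRectangular : Pred (List⁺ ℕ) 0ℓ
AlmostRectangular (x ∷ xs) = Extrema.max x xs ∸ Extrema.min x xs ≤ 1

almostRectangular? : Decidable AlmostRectangular
almostRectangular? (x ∷ xs) = Extrema.max x xs ∸ Extrema.min x xs ≤? 1

-- All ways of putting x into one of the given subpartitions or into a new one.
insert : ℕ → List (List⁺ ℕ) → List (List (List⁺ ℕ))
insert x []       = ([ x ] ∷ []) ∷ []
insert x (q ∷ qs) = ((x ∷⁺ q) ∷ qs) ∷ map (q ∷_) (insert x qs)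

-- All decompositions of a multiset into nonempty submultisets.
decompositions : List ℕ → List (List (List⁺ ℕ))
decompositions []       = [] ∷ []
decompositions (x ∷ xs) = concatMap (insert x) (decompositions xs)

r : List Block → ℕ
r bs = minimum
  (map length (filter (all? almostRectangular?) (decompositions (parts bs))))

------------------------------------------------------------------------
-- The invariant μ(P)

-- x₁, x₂, … , with 0 beyond the end of the list.
_‼_ : List ℕ → ℕ → ℕ
[]       ‼ _           = 0
(x ∷ xs) ‼ zero        = 0
(x ∷ xs) ‼ suc zero    = x
(x ∷ xs) ‼ suc (suc i) = xs ‼ suc i

-- The blocks of a spread, from its smallest part up.
Spread : Set
Spread = List⁺ Block

_-ˢ_ : Spread → ℕ → Spread
Q -ˢ c = List⁺.map (λ (p , n) → p ∸ c , n) Q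

μ-spread : Spread → ℕ
μ-spread Q = minimum
  (map (λ (i , j) → p * (ns ‼ (2 * i ∸ 1)) + (p + 1) * (ns ‼ (2 * j)))
       (filter (λ (i , j) → i ≤? j) (cartesianProduct [1⋯ rQ ] [1⋯ rQ ])))
  where
  p  = proj₁ (List⁺.head Q)
  ns = map proj₂ (toList Q)
  rQ = r (toList Q)

attach : Block → List Spread → List Spread
attach b []       = [ b ] ∷ []
attach b (Q ∷ Qs) =
  if proj₁ (List⁺.head Q) ≡ᵇ suc (proj₁ b)
  then (b ∷⁺ Q) ∷ Qs
  else [ b ] ∷ Q ∷ Qs

-- P₁, …, P_ℓ: the decomposition into spreads with gaps of at least 2 between
-- them is the one into maximal runs of consecutive parts.
spreads : List Block → List Spread
spreads []       = []
spreads (b ∷ bs) = attach b (spreads bs)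

-- From P_k, P_{k+1}, … and r̄ = r̄_k, the spreads P_k - 2 r̄_k, P_{k+1} - 2 r̄_{k+1}, …
-- The subtractions are not truncated and the parts stay positive: for an
-- s-spread r is ⌈ s /2⌉, and the smallest part of P_{k+1} exceeds that of P_k
-- by at least s + 1 ≥ 2 ⌈ s /2⌉.
reduced : ℕ → List Spread → List Spread
reduced r̄ []       = []
reduced r̄ (Q ∷ Qs) = (Q -ˢ (2 * r̄)) ∷ reduced (r̄ + r (toList Q)) Qs

μ : Partition → ℕ
μ P = minimum (map μ-spread (reduced 0 (spreads (blocks P))))

{-# OPTIONS --safe #-}
-- List the multiplicities n₀ = 0, n₁, n₂, … on a line.  An element of 𝒟_P with
-- part p is missed by U_A only if p ∉ A, and then p - 2 #{i : aᵢ < p} of the p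
-- values of u are missed.  So if the dominoes {aᵢ , aᵢ + 1} are deleted from the
-- line, leaving w₀, w₁, …, then n - ∣U_A∣ = Σ t wₜ =: cost.  Any two adjacent
-- entries wₜ, wₜ₊₁ can be deleted by one more domino, which lowers the cost by
-- t wₜ + (t + 1) wₜ₊₁ at least.
--
-- Tiling every spread greedily with r = r(P) dominoes gives cost 0, that is,
-- u_r = n.  Let p be the smallest part of a spread P_k minus 2 r̄_k.  Leaving out
-- n_{2i-1} and n_{2j} in P_k takes r - 1 dominoes and has cost
-- p n_{2i-1} + (p + 1) n_{2j}, whence u_{r-1} ≥ n - μ.  Conversely, compare m < r
-- dominoes with the greedy ones from left to right: where they first fall
-- behind, the remaining entries with indices p and p + 1 are some n_{2i-1} and
-- n_{2j} with i ≤ j (or just the first one matters, as n_{2j} = n_{s+1} = 0).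
-- Hence u_{m+1} ≥ u_m + μ for all m < r.
module Submission where

open import Defs
open import Data.Bool using (true; false)
open import Data.Empty using (⊥; ⊥-elim)
open import Data.Fin as Fin using (Fin; toℕ)
import Data.Fin.Properties as Fin
open import Data.List as List using (List; []; _∷_; _++_; [_]; replicate; length; map; concatMap; filter; cartesianProduct; upTo; applyUpTo)
import Data.List.Extrema.Nat as Extrema
open import Data.List.Membership.Propositional using (_∈_; lose; find)
open import Data.List.Membership.Propositional.Properties using (∈-map⁺; ∈-map⁻; ∈-filter⁺; ∈-filter⁻; ∈-++⁺ʳ; ∈-concatMap⁺; ∈-concatMap⁻; ∈-cartesianProduct⁺; ∈-cartesianProduct⁻; ∈-upTo⁺; ∈-upTo⁻)
open import Data.List.NonEmpty using (List⁺; _∷_; _∷⁺_; toList)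
open import Data.List.Properties using (length-++; length-map; filter-++; filter-all; filter-none; map-++; cartesianProductWith-distribʳ-++; map-applyUpTo; length-applyUpTo; length-upTo)
open import Data.List.Relation.Unary.All as All using (All; []; _∷_)
import Data.List.Relation.Unary.All.Properties as All
open import Data.List.Relation.Unary.Any as Any using (Any; here; there)
open import Data.List.Relation.Unary.Any.Properties using (lookup-index)
open import Data.List.Relation.Unary.Linked using (Linked; [-]; _∷_)
open import Data.Maybe using (Maybe; just; nothing)
open import Data.Nat
open import Data.Nat.ListAction using (sum)
open import Data.Nat.Properties
open import Data.Nat.Tactic.RingSolver using (solve-∀)
open import Data.Product using (_×_; _,_; ∃-syntax; proj₁; proj₂; uncurry)
open import Data.Sum as Sum using (_⊎_; inj₁; inj₂; map₁; map₂)
open import Data.Vec as Vec using (Vec; []; _∷_)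
open import Data.Vec.Relation.Unary.Linked using ([]; [-]; _∷_)
open import Function using (_∘_; id)
open import Level using (0ℓ)
open import Relation.Binary.PropositionalEquality using (_≡_; refl; sym; trans; cong; cong₂; subst; subst₂; module ≡-Reasoning)
open import Relation.Nullary using (¬_; yes; no; contradiction)
open import Relation.Unary using (Pred)

-- Domino tilings

-- Tiling ws rs m: deleting m disjoint dominoes (pairs of adjacent entries) from
-- ws leaves rs.  Dominoes may lie beyond the end of ws, or stick out of it.
data Tiling : List ℕ → List ℕ → ℕ → Set where
  done   : ∀ {m} → Tiling [] [] m
  half   : ∀ {a m} → Tiling (a ∷ []) [] (suc m)
  skip   : ∀ {a ws rs m} → Tiling ws rs m → Tiling (a ∷ ws) (a ∷ rs) m
  domino : ∀ {a b ws rs m} → Tiling ws rs m → Tiling (a ∷ b ∷ ws) rs (suc m)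

cost : ℕ → List ℕ → ℕ
cost t []       = 0
cost t (w ∷ rs) = t * w + cost (suc t) rs

cost-≤-suc : ∀ t rs → cost t rs ≤ cost (suc t) rs
cost-≤-suc t []       = z≤n
cost-≤-suc t (w ∷ rs) = +-mono-≤ (m≤n+m (t * w) w) (cost-≤-suc (suc t) rs)

cost-zeros : ∀ t {rs} → All (_≡ 0) rs → cost t rs ≡ 0
cost-zeros t []         = refl
cost-zeros t (refl ∷ z) = cong₂ _+_ (*-zeroʳ t) (cost-zeros (suc t) z)

Tiling-mono : ∀ {ws rs m n} → m ≤ n → Tiling ws rs m → Tiling ws rs n
Tiling-mono m≤n       done       = done
Tiling-mono (s≤s m≤n) half       = half
Tiling-mono m≤n       (skip T)   = skip (Tiling-mono m≤n T)
Tiling-mono (s≤s m≤n) (domino T) = domino (Tiling-mono m≤n T)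

-- The dominoes between an uncovered entry and the next one are shifted by one
-- place to cover both.
shift : ∀ {a b ws rs m} → Tiling ws (b ∷ rs) m → Tiling (a ∷ ws) rs (suc m)
shift (skip T)   = domino T
shift (domino T) = domino (shift T)

-- With no uncovered entry behind `a`, the shift runs to the end of the list, where it makes the
-- last domino stick out or takes it back in.
shift-last : ∀ {a ws m} → Tiling ws [] m → Tiling (a ∷ ws) [] (suc m)
shift-last done       = half
shift-last half       = domino done
shift-last (domino T) = domino (shift-last T)

-- Deleting two adjacent entries (or the last one) of the list, whose first
-- entry has index t, lowers the cost by at least M.
data Gain (M : ℕ) : ℕ → List ℕ → Set where
  pair  : ∀ {t a b rs} → M ≤ t * a + suc t * b → Gain M t (a ∷ b ∷ rs)
  last  : ∀ {t a} → M ≤ t * a → Gain M t (a ∷ [])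
  there : ∀ {t a rs} → Gain M (suc t) rs → Gain M t (a ∷ rs)

gain-single : ∀ {M t a} rs → M ≤ t * a → Gain M t (a ∷ rs)
gain-single []       l = last l
gain-single (b ∷ rs) l = pair (≤-trans l (m≤m+n _ _))

improve : ∀ {M t ws rs m} → Tiling ws rs m → Gain M t rs →
  ∃[ rs′ ] Tiling ws rs′ (suc m) × cost t rs′ + M ≤ cost t rs
-- Once the pair is deleted, the indices of the entries behind it drop by two; hence `cost-≤-suc`
-- twice.
improve {M} {t} (skip {a} T) (pair {b = b} {rs = rs} l) = rs , shift T , (begin
  cost t rs + M                                     ≤⟨ +-mono-≤ (≤-trans (cost-≤-suc t rs) (cost-≤-suc (suc t) rs)) l ⟩
  cost (2 + t) rs + (t * a + suc t * b)             ≡⟨ +-comm (cost (2 + t) rs) _ ⟩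
  t * a + suc t * b + cost (2 + t) rs               ≡⟨ +-assoc (t * a) _ _ ⟩
  t * a + (suc t * b + cost (2 + t) rs)             ∎)
  where open ≤-Reasoning
improve (skip T) (last l) = [] , shift-last T , ≤-trans l (m≤m+n _ 0)
improve {M} {t} (skip {a} T) (there G) with improve T G
... | rs′ , T′ , l = a ∷ rs′ , skip T′ ,
  ≤-trans (≤-reflexive (+-assoc (t * a) _ M)) (+-monoʳ-≤ (t * a) l)
improve (domino T) G with improve T G
... | rs′ , T′ , l = rs′ , domino T′ , l

-- Spreads on the line

-- (g , ns): a gap of g + 1 positions followed by a spread with multiplicities ns.
Run : Set
Run = ℕ × List⁺ ℕ

line : List Run → List ℕ
line []                      = []
line ((g , n ∷ ns) ∷ runs) = 0 ∷ replicate g 0 ++ n ∷ ns ++ line runs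

need : List Run → ℕ
need []                = 0
need ((g , ns) ∷ runs) = ⌈ length (toList ns) /2⌉ + need runs

-- The values n_{2j}, including n_{s+1} = 0 if s is odd.
data EvenEntry : List ℕ → ℕ → Set where
  pad   : ∀ {a} → EvenEntry (a ∷ []) 0
  here  : ∀ {a b ns} → EvenEntry (a ∷ b ∷ ns) b
  there : ∀ {a b ns e} → EvenEntry ns e → EvenEntry (a ∷ b ∷ ns) e

-- The pairs (n_{2i-1} , n_{2j}) with i ≤ j.
data OddEven : List ℕ → ℕ → ℕ → Set where
  here  : ∀ {a ns e} → EvenEntry (a ∷ ns) e → OddEven (a ∷ ns) a e
  there : ∀ {a b ns o e} → OddEven ns o e → OddEven (a ∷ b ∷ ns) o e

-- If p is the position of the first entry of ns minus 2 r̄, this is the position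
-- after its last entry minus 2 (r̄ + ⌈ s /2⌉).
after : ℕ → List ℕ → ℕ
after p []           = p
after p (_ ∷ [])     = pred p
after p (_ ∷ _ ∷ ns) = after p ns

-- The numbers over which the minimum μ is taken, for a line whose first
-- position minus 2 r̄ is b.
data Term : ℕ → List Run → ℕ → Set where
  here  : ∀ {b g ns runs o e} → OddEven (toList ns) o e →
    Term b ((g , ns) ∷ runs) (suc (b + g) * o + suc (suc (b + g)) * e)
  there : ∀ {b g ns runs t} → Term (after (suc (b + g)) (toList ns)) runs t →
    Term b ((g , ns) ∷ runs) t

-- Greedy tilings and tilings that realise a term

zeros : ∀ g {ws rs m} → Tiling ws rs m → Tiling (replicate g 0 ++ ws) (replicate g 0 ++ rs) m
zeros zero    T = T
zeros (suc g) T = skip (zeros g T)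

zeros-all : ∀ g {rs} → All (_≡ 0) rs → All (_≡ 0) (replicate g 0 ++ rs)
zeros-all zero    z = z
zeros-all (suc g) z = refl ∷ zeros-all g z

cost-shift : ∀ t g rs → cost t (replicate g 0 ++ rs) ≡ cost (t + g) rs
cost-shift t zero    rs = cong (λ k → cost k rs) (sym (+-identityʳ t))
cost-shift t (suc g) rs = trans (cong (_+ cost (suc t) (replicate g 0 ++ rs)) (*-zeroʳ t))
  (trans (cost-shift (suc t) g rs) (cong (λ k → cost k rs) (sym (+-suc t g))))

ZeroTiling : List ℕ → ℕ → Set
ZeroTiling ws m = ∃[ rs ] Tiling ws rs m × All (_≡ 0) rs

-- A spread of odd length takes one position of the gap behind it.
greedy-body : ∀ g n ns runs → ZeroTiling (replicate g 0 ++ n ∷ ns ++ line runs) (need ((g , n ∷ ns) ∷ runs))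
greedy-spread : ∀ ns runs → ZeroTiling (ns ++ line runs) (⌈ length ns /2⌉ + need runs)
greedy : ∀ runs → ZeroTiling (line runs) (need runs)

greedy-body g n ns runs with greedy-spread (n ∷ ns) runs
... | rs , T , z = replicate g 0 ++ rs , zeros g T , zeros-all g z

greedy-spread []           runs = greedy runs
greedy-spread (a ∷ [])     [] = [] , half , []
greedy-spread (a ∷ [])     ((g , n ∷ ns) ∷ runs) with greedy-body g n ns runs
... | rs , T , z = rs , domino T , z
greedy-spread (a ∷ b ∷ ns) runs with greedy-spread ns runs
... | rs , T , z = rs , domino T , z

greedy [] = [] , done , []
greedy ((g , n ∷ ns) ∷ runs) with greedy-body g n ns runs
... | rs , T , z = 0 ∷ rs , skip T , refl ∷ z

CostTiling : ℕ → List ℕ → ℕ → ℕ → Set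
CostTiling t ws m c = ∃[ rs ] Tiling ws rs m × cost t rs ≡ c

-- Behind the omitted n_{2i-1} the dominoes cover the pairs n_{2k}, n_{2k+1}. Once n_{2j} is omitted
-- they fall back on the greedy pairs, so one domino is saved. For n_{s+1} this happens behind the
-- spread.
omit-even : ∀ {a e} t ns runs → EvenEntry (a ∷ ns) e →
  ∃[ h ] suc h ≡ ⌈ length (a ∷ ns) /2⌉ × CostTiling t (ns ++ line runs) (h + need runs) (t * e)
omit-even t [] runs pad with greedy runs
... | rs , T , z = 0 , refl , rs , T , trans (cost-zeros t z) (sym (*-zeroʳ t))
omit-even t (b ∷ ns) runs here with greedy-spread ns runs
... | rs , T , z = _ , refl , b ∷ rs , skip T ,
  trans (cong (t * b +_) (cost-zeros (suc t) z)) (+-identityʳ _)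
omit-even t (b ∷ a′ ∷ ns) runs (there E) with omit-even t ns runs E
... | h , eq , rs , T , c = suc h , cong suc eq , rs , domino T , c

omit : ∀ {o e} p ns runs → OddEven ns o e →
  ∃[ h ] suc h ≡ ⌈ length ns /2⌉ × CostTiling p (ns ++ line runs) (h + need runs) (p * o + suc p * e)
omit p (a ∷ ns) runs (here E) with omit-even (suc p) ns runs E
... | h , eq , rs , T , c = h , eq , a ∷ rs , skip T , cong (p * a +_) c
omit p (a ∷ b ∷ ns) runs (there E) with omit p ns runs E
... | h , eq , rs , T , c = suc h , cong suc eq , rs , domino T , c

-- The spreads in front of the one that the term belongs to are tiled greedily. Every domino lowers
-- the indices behind it by two, which `after` records.
term-spread : ∀ {c} p ns runs → 1 ≤ p → Term (after p ns) runs c →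
  ∃[ h ] suc h ≡ ⌈ length ns /2⌉ + need runs × CostTiling p (ns ++ line runs) h c
term-body : ∀ {b c} g n ns runs → Term b ((g , n ∷ ns) ∷ runs) c →
  ∃[ h ] suc h ≡ need ((g , n ∷ ns) ∷ runs) ×
    CostTiling (suc b) (replicate g 0 ++ n ∷ ns ++ line runs) h c
term : ∀ {b c} runs → Term b runs c →
  ∃[ h ] suc h ≡ need runs × CostTiling b (line runs) h c

term-spread p [] runs 1≤p τ = term runs τ
-- The odd last entry shares its domino with the leading zero of the next run, so what follows is a
-- body without that zero.
term-spread (suc p) (a ∷ []) ((g , n ∷ ns) ∷ runs) 1≤p τ with term-body g n ns runs τ
... | h , eq , rs , T , c = suc h , cong suc eq , rs , domino T , c
term-spread p (a ∷ b ∷ ns) runs 1≤p τ with term-spread p ns runs 1≤p τ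
... | h , eq , rs , T , c = suc h , cong suc eq , rs , domino T , c

term-body {b} g n ns runs (here E) with omit (suc (b + g)) (n ∷ ns) runs E
... | h , eq , rs , T , c = _ , cong (_+ need runs) eq , replicate g 0 ++ rs , zeros g T ,
  trans (cost-shift (suc b) g rs) c
term-body {b} g n ns runs (there τ) with term-spread (suc (b + g)) (n ∷ ns) runs (s≤s z≤n) τ
... | h , eq , rs , T , c = h , eq , replicate g 0 ++ rs , zeros g T ,
  trans (cost-shift (suc b) g rs) c

term {b} ((g , n ∷ ns) ∷ runs) τ with term-body g n ns runs τ
... | h , eq , rs , T , c = h , eq , 0 ∷ rs , skip T ,
  trans (cong (_+ cost (suc b) rs) (*-zeroʳ b)) c

-- Comparing a tiling with the greedy one

-- R + 2 σ ≡ b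
data Surplus : ℕ → ℕ → ℕ → Set where
  base : ∀ {b} → Surplus b b 0
  step : ∀ {R b σ} → Surplus (2 + R) b σ → Surplus R b (suc σ)

surplus-suc : ∀ {R b σ} → Surplus R b σ → Surplus (suc R) (suc b) σ
surplus-suc base     = base
surplus-suc (step s) = step (surplus-suc s)

surplus-pred : ∀ {R b σ} → Surplus (suc R) b σ → Surplus R (pred b) σ
surplus-pred base     = base
surplus-pred (step s) = step (surplus-pred s)

surplus-+2 : ∀ {R b σ} → Surplus R b σ → Surplus R (2 + b) (suc σ)
surplus-+2 base     = step base
surplus-+2 (step s) = step (surplus-+2 s)

-- A tiling is scanned from left to right.  R counts the uncovered positions so
-- far; σ is the number of dominoes so far minus the number of dominoes of the
-- greedy tiling so far.  At a position x not inside a domino, R + 2 σ is x minus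
-- twice the latter number; inside a domino it is one more.  The surplus σ never
-- gets negative unless a gain of M is met.
module Scan (M : ℕ) where

  SpreadBound : ℕ → List ℕ → Set
  SpreadBound p ns = ∀ {o e} → OddEven ns o e → M ≤ p * o + suc p * e

  Bound : ℕ → List Run → Set
  Bound b runs = ∀ {t} → Term b runs t → M ≤ t

  scan-line : ∀ runs {b R σ rs m} → Bound b runs → Surplus R b σ →
    Tiling (line runs) rs m → Gain M R rs ⊎ need runs ≤ m + σ

  scan-gap : ∀ g n ns runs {b p R σ rs m} → 1 ≤ p → b + g ≡ p →
    SpreadBound p (n ∷ ns) → Bound (after p (n ∷ ns)) runs → Surplus R b σ →
    Tiling (replicate g 0 ++ n ∷ ns ++ line runs) rs m →
    Gain M R rs ⊎ ⌈ length (n ∷ ns) /2⌉ + need runs ≤ m + σ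

  scan-spread : ∀ ns runs {p R σ rs m} → 1 ≤ p →
    SpreadBound p ns → Bound (after p ns) runs → Surplus R p σ →
    Tiling (ns ++ line runs) rs m →
    Gain M R rs ⊎ ⌈ length ns /2⌉ + need runs ≤ m + σ

  -- Here the entry a in front of ns is either uncovered or the second entry of
  -- a domino.  If σ = 0, then the last uncovered entry was some n_{2i-1}.
  scan-even : ∀ a ns runs {p R σ rs m} {G : Set} → 1 ≤ p →
    SpreadBound p (a ∷ ns) → Bound (after p (a ∷ ns)) runs → Surplus R (suc p) σ →
    (Gain M R rs → G) →
    (σ ≡ 0 → ∃[ o ] (∀ {e} → EvenEntry (a ∷ ns) e → M ≤ p * o + suc p * e) × (Gain M p (o ∷ rs) → G)) →
    Tiling (ns ++ line runs) rs m →
    G ⊎ ⌈ length (a ∷ ns) /2⌉ + need runs ≤ m + σ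

  ≤-+-suc : ∀ {x} m σ → x ≤ m + σ → suc x ≤ m + suc σ
  ≤-+-suc m σ l = ≤-trans (s≤s l) (≤-reflexive (sym (+-suc m σ)))

  scan-line []                    B s T = inj₂ z≤n
  scan-line ((g , n ∷ ns) ∷ runs) {b} B s T =
    scan-gap (suc g) n ns runs (s≤s z≤n) (+-suc b g) (B ∘ here) (B ∘ there) s T

  scan-gap zero n ns runs {b} 1≤p eq S B s T with trans (sym (+-identityʳ b)) eq
  ... | refl = scan-spread (n ∷ ns) runs 1≤p S B s T
  -- No greedy domino starts inside a gap, so the surplus grows by one.
  scan-gap (suc (suc g)) n ns runs {b} {σ = σ} {m = suc m} 1≤p eq S B s (domino T) =
    map₂ (λ l → ≤-trans l (≤-reflexive (+-suc m σ)))
      (scan-gap g n ns runs 1≤p (trans (trans (cong suc (sym (+-suc b g))) (sym (+-suc b (suc g)))) eq) S B (surplus-+2 s) T)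
  -- The domino takes the last zero of the gap together with `n`. The surplus is now positive, so
  -- nothing is asked about the last uncovered entry.
  scan-gap (suc zero) n ns runs {b} {σ = σ} {m = suc m} 1≤p eq S B s (domino T) with trans (sym (+-comm b 1)) eq
  ... | refl = map₂ (λ l → ≤-trans l (≤-reflexive (+-suc m σ)))
      (scan-even n ns runs 1≤p S B (surplus-+2 s) id (λ ()) T)
  scan-gap (suc g) n ns runs {b} 1≤p eq S B s (skip T) =
    map₁ there (scan-gap g n ns runs 1≤p (trans (sym (+-suc b g)) eq) S B (surplus-suc s) T)

  scan-spread [] runs 1≤p S B s T = scan-line runs B s T
  scan-spread (a ∷ []) [] 1≤p S B s half = inj₂ (s≤s z≤n)
  scan-spread (a ∷ []) ((g , n ∷ ns) ∷ runs) {p = suc p} 1≤p S B s (domino T) =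
    map₂ s≤s (scan-gap g n ns runs (s≤s z≤n) refl (B ∘ here) (B ∘ there) s T)
  scan-spread (a ∷ b ∷ ns) runs 1≤p S B s (domino T) =
    map₂ s≤s (scan-spread ns runs 1≤p (S ∘ there) B s T)
  -- Leaving `a` uncovered puts the tiling out of step with the greedy pairs. If the surplus is
  -- zero, then `a` has index `p` and is itself the pending odd entry.
  scan-spread (a ∷ ns) runs {p} {R} {σ} {a ∷ rs} 1≤p S B s (skip T) =
    scan-even a ns runs 1≤p S B (surplus-suc s) there (pending s) T
    where
    pending : ∀ {R σ} → Surplus R p σ → σ ≡ 0 →
      ∃[ o ] (∀ {e} → EvenEntry (a ∷ ns) e → M ≤ p * o + suc p * e) × (Gain M p (o ∷ rs) → Gain M R (a ∷ rs))
    pending base refl = a , S ∘ here , id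

  -- The tiling falls behind at the end of an odd spread. The partner of `o` is n_{s+1} = 0, so `o`
  -- alone yields the gain, whatever entry follows it.
  scan-even a [] runs {p} 1≤p S B base f pending T with pending refl
  ... | o , S₀ , k = inj₁ (k (gain-single _ (≤-trans (S₀ pad) (≤-reflexive (trans (cong (p * o +_) (*-zeroʳ p)) (+-identityʳ (p * o)))))))
  -- Counting the greedy domino that begins at `a` uses one unit of the surplus and turns the
  -- position `suc p` into `pred p`.
  scan-even a [] runs {σ = suc σ} {m = m} 1≤p S B (step s) f pending T =
    Sum.map f (≤-+-suc m σ) (scan-line runs B (surplus-pred (surplus-pred s)) T)
  scan-even a (b ∷ []) [] 1≤p S B s f pending half = inj₂ (s≤s z≤n)
  scan-even a (b ∷ []) ((g , n ∷ ns) ∷ runs) 1≤p S B s f pending (domino T) =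
    Sum.map f s≤s (scan-gap g n ns runs (s≤s z≤n) refl (B ∘ here) (B ∘ there) s T)
  scan-even a (b ∷ a′ ∷ ns) runs 1≤p S B s f pending (domino T) =
    Sum.map id s≤s (scan-even a′ ns runs 1≤p (S ∘ there) B s f
      (λ eq → let o , S₀ , k = pending eq in o , S₀ ∘ there , k) T)
  -- Without surplus, `o` and `b` are successive uncovered entries with indices `p` and `suc p`,
  -- that is, a pair n_{2i-1}, n_{2j}.
  scan-even a (b ∷ ns) runs 1≤p S B base f pending (skip T) with pending refl
  ... | o , S₀ , k = inj₁ (k (pair (S₀ here)))
  scan-even a (b ∷ ns) runs {σ = suc σ} {m = m} 1≤p S B (step s) f pending (skip T) =
    Sum.map (f ∘ there) (≤-+-suc m σ) (scan-spread ns runs 1≤p (S ∘ there) B (surplus-pred s) T)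

-- The number r of a spread

minimum-≤ : ∀ {x xs} → x ∈ xs → minimum xs ≤ x
minimum-≤ {xs = y ∷ ys} (here refl) = Extrema.min≤⊤ y ys
minimum-≤ {xs = y ∷ ys} (there x∈) = All.lookup (Extrema.min≤xs y ys) x∈

minimum-∈ : ∀ {x xs} → x ∈ xs → minimum xs ∈ xs
minimum-∈ {xs = y ∷ ys} _ with Extrema.argmin-sel id y ys
... | inj₁ eq = here eq
... | inj₂ z∈ = there z∈

≤-minimum : ∀ {x v xs} → x ∈ xs → (∀ {y} → y ∈ xs → v ≤ y) → v ≤ minimum xs
≤-minimum x∈ h = h (minimum-∈ x∈)

consec : ℕ → List ℕ → List Block
consec p []       = []
consec p (n ∷ ns) = (p , n) ∷ consec (suc p) ns

almostRectangular⁺ : ∀ {p} q → All (λ y → p ≤ y × y ≤ suc p) (toList q) → AlmostRectangular q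
almostRectangular⁺ {p} (x ∷ xs) ((p≤x , x≤p) ∷ h) = ≤-trans
  (∸-mono (Extrema.max≤v⁺ {xs = xs} x≤p (All.map proj₂ h)) (Extrema.v≤min⁺ {xs = xs} p≤x (All.map proj₁ h)))
  (≤-reflexive (m+n∸n≡m 1 p))

almostRectangular⁻ : ∀ {y z} q → AlmostRectangular q → y ∈ toList q → z ∈ toList q → y ≤ suc z
almostRectangular⁻ {y} {z} (x ∷ xs) h y∈ z∈ = begin
  y                             ≤⟨ All.lookup (Extrema.⊥≤max x xs ∷ Extrema.xs≤max x xs) y∈ ⟩
  max                           ≤⟨ m≤n+m∸n max min ⟩
  min + (max ∸ min)             ≤⟨ +-monoʳ-≤ min h ⟩
  min + 1                       ≡⟨ +-comm min 1 ⟩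
  suc min                       ≤⟨ s≤s (All.lookup (Extrema.min≤⊤ x xs ∷ Extrema.min≤xs x xs) z∈) ⟩
  suc z                         ∎
  where
  open ≤-Reasoning
  max = Extrema.max x xs
  min = Extrema.min x xs

Covered : List (List⁺ ℕ) → ℕ → Set
Covered d x = Any (λ q → x ∈ toList q) d

insert-new : ∀ {x d} qs → d ∈ insert x qs → Covered d x
insert-new []       (here refl) = here (here refl)
insert-new (q ∷ qs) (here refl) = here (here refl)
insert-new (q ∷ qs) (there d∈) with ∈-map⁻ (q ∷_) d∈
... | _ , d′∈ , refl = there (insert-new qs d′∈)

insert-old : ∀ {x y d} qs → d ∈ insert x qs → Covered qs y → Covered d y
insert-old (q ∷ qs) (here refl) (here y∈)  = here (there y∈)
insert-old (q ∷ qs) (here refl) (there c)  = there c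
insert-old (q ∷ qs) (there d∈) c with ∈-map⁻ (q ∷_) d∈ | c
... | _ , d′∈ , refl | here y∈ = here y∈
... | _ , d′∈ , refl | there c′ = there (insert-old qs d′∈ c′)

decomposition-covers : ∀ {d} xs → d ∈ decompositions xs → ∀ {x} → x ∈ xs → Covered d x
decomposition-covers (x ∷ xs) d∈ y∈ with find (∈-concatMap⁻ (insert x) {xs = decompositions xs} d∈) | y∈
... | qs , qs∈ , d∈′ | here refl = insert-new qs d∈′
... | qs , qs∈ , d∈′ | there y∈′ = insert-old qs d∈′ (decomposition-covers xs qs∈ y∈′)

∈-decompositions : ∀ {x qs d} xs → qs ∈ decompositions xs → d ∈ insert x qs → d ∈ decompositions (x ∷ xs)
∈-decompositions {x} xs qs∈ d∈ = ∈-concatMap⁺ (insert x) (lose qs∈ d∈)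

odd-part : ∀ {p ns i} → All (1 ≤_) ns → i < ⌈ length ns /2⌉ → p + 2 * i ∈ parts (consec p ns)
odd-part {p} {suc a ∷ ns} {zero} h i< = here (+-identityʳ p)
odd-part {p} {a ∷ b ∷ ns} {suc i} (_ ∷ _ ∷ h) (s≤s i<) =
  ∈-++⁺ʳ (replicate a p) (∈-++⁺ʳ (replicate b (suc p))
    (subst (_∈ parts (consec (2 + p) ns)) eq (odd-part h i<)))
  where
  eq : 2 + p + 2 * i ≡ p + 2 * suc i
  eq = trans (cong (_+ 2 * i) (+-comm 2 p))
        (trans (+-assoc p 2 (2 * i)) (cong (p +_) (sym (*-suc 2 i))))

-- The parts p, p + 2, p + 4, … lie in different subpartitions.
almostRectangular-count : ∀ {p ns d} → All (1 ≤_) ns → d ∈ decompositions (parts (consec p ns)) →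
  All AlmostRectangular d → ⌈ length ns /2⌉ ≤ length d
almostRectangular-count {p} {ns} {d} h d∈ ar = Fin.injective⇒≤ injective
  where
  covered : ∀ (i : Fin ⌈ length ns /2⌉) → Covered d (p + 2 * toℕ i)
  covered i = decomposition-covers _ d∈ (odd-part {p} h (Fin.toℕ<n i))
  f : Fin ⌈ length ns /2⌉ → Fin (length d)
  f i = Any.index (covered i)
  close : ∀ i j → f i ≡ f j → toℕ i ≤ toℕ j
  close i j eq = ≮⇒≥ λ j<i → <-irrefl refl (begin-strict
    suc (p + 2 * toℕ j)   <⟨ n<1+n _ ⟩
    2 + (p + 2 * toℕ j)   ≡⟨ trans (+-comm 2 _) (trans (+-assoc p _ 2) (cong (p +_) (trans (+-comm _ 2) (sym (*-suc 2 (toℕ j)))))) ⟩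
    p + 2 * suc (toℕ j)   ≤⟨ +-monoʳ-≤ p (*-monoʳ-≤ 2 j<i) ⟩
    p + 2 * toℕ i         ≤⟨ almostRectangular⁻ (List.lookup d (f i)) (All.lookupAny ar (covered i) .proj₁)
                               (lookup-index (covered i))
                               (subst (λ k → p + 2 * toℕ j ∈ toList (List.lookup d k)) (sym eq) (lookup-index (covered j))) ⟩
    suc (p + 2 * toℕ j)   ∎)
    where open ≤-Reasoning
  injective : ∀ {i j} → f i ≡ f j → i ≡ j
  injective {i} {j} eq = Fin.toℕ-injective (≤-antisym (close i j eq) (close j i (sym eq)))

insert-at-end : ∀ x q d → d ++ [ x ∷⁺ q ] ∈ insert x (d ++ [ q ])
insert-at-end x q []       = here refl
insert-at-end x q (q′ ∷ d) = there (∈-map⁺ (q′ ∷_) (insert-at-end x q d))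

insert-new-end : ∀ x d → d ++ [ x ∷ [] ] ∈ insert x d
insert-new-end x []       = here refl
insert-new-end x (q′ ∷ d) = there (∈-map⁺ (q′ ∷_) (insert-new-end x d))

-- `d` decomposes the larger parts already treated, while `q` is still collecting copies of `p` and
-- `suc p`.
LastWithin : ℕ → List (List⁺ ℕ) → List ℕ → Set
LastWithin p d xs = ∃[ q ] All (λ y → p ≤ y × y ≤ suc p) (toList q) × d ++ [ q ] ∈ decompositions xs

extend : ∀ {p d} xs x k → p ≤ x × x ≤ suc p → LastWithin p d xs → LastWithin p d (replicate k x ++ xs)
extend xs x zero    h l = l
extend {d = d} xs x (suc k) h l with extend {d = d} xs x k h l
... | q , hq , q∈ = x ∷⁺ q , h ∷ hq , ∈-decompositions (replicate k x ++ xs) q∈ (insert-at-end x q d)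

start : ∀ {p d} xs x k → p ≤ x × x ≤ suc p → 1 ≤ k → d ∈ decompositions xs →
  LastWithin p d (replicate k x ++ xs)
start {d = d} xs x (suc zero) h _ d∈ = x ∷ [] , h ∷ [] , ∈-decompositions xs d∈ (insert-new-end x d)
start {d = d} xs x (suc (suc k)) h _ d∈ with start xs x (suc k) h (s≤s z≤n) d∈
... | q , hq , q∈ = x ∷⁺ q , h ∷ hq , ∈-decompositions (replicate (suc k) x ++ xs) q∈ (insert-at-end x q d)

Economical : List ℕ → ℕ → Set
Economical xs h = ∃[ d ] d ∈ decompositions xs × All AlmostRectangular d × length d ≡ h

close-last : ∀ {p d h} xs → All AlmostRectangular d → length d ≡ h → LastWithin p d xs → Economical xs (suc h)
close-last {d = d} xs ar eq (q , hq , q∈) = d ++ [ q ] , q∈ ,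
  All.++⁺ ar (almostRectangular⁺ q hq ∷ []) , trans (length-++ d) (trans (+-comm _ 1) (cong suc eq))

-- The parts are grouped as p, p + 1 | p + 2, p + 3 | ..., with the largest part on its own if their
-- number is odd.
economical : ∀ p ns → All (1 ≤_) ns → Economical (parts (consec p ns)) ⌈ length ns /2⌉
economical p [] h = [] , here refl , [] , refl
economical p (a ∷ []) (1≤a ∷ _) =
  close-last {d = []} (replicate a p ++ []) [] refl (start [] p a (≤-refl , n≤1+n p) 1≤a (here refl))
economical p (a ∷ b ∷ ns) (_ ∷ 1≤b ∷ h) with economical (2 + p) ns h
... | d , d∈ , ar , eq = close-last {d = d} (replicate a p ++ replicate b (suc p) ++ xs) ar eq
  (extend {d = d} (replicate b (suc p) ++ xs) p a (≤-refl , n≤1+n p) (start xs (suc p) b (n≤1+n p , ≤-refl) 1≤b d∈))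
  where xs = parts (consec (2 + p) ns)

r-consec : ∀ p ns → All (1 ≤_) ns → r (consec p ns) ≡ ⌈ length ns /2⌉
r-consec p ns h with economical p ns h
... | d , d∈ , ar , eq = ≤-antisym
  (≤-trans (minimum-≤ len∈) (≤-reflexive eq))
  (≤-minimum len∈ bound)
  where
  candidates = decompositions (parts (consec p ns))
  len∈ : length d ∈ map length (filter (All.all? almostRectangular?) candidates)
  len∈ = ∈-map⁺ length (∈-filter⁺ (All.all? almostRectangular?) d∈ ar)
  bound : ∀ {y} → y ∈ map length (filter (All.all? almostRectangular?) candidates) → ⌈ length ns /2⌉ ≤ y
  bound y∈ with ∈-map⁻ length y∈
  ... | d′ , d′∈ , refl with ∈-filter⁻ (All.all? almostRectangular?) {xs = candidates} d′∈
  ... | d∈′ , ar′ = almostRectangular-count {p} h d∈′ ar′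

-- The cardinality of a U-chain

-- `IsIndexSet` with an explicit lower bound, as needed for inductions along the line.
data Spaced : ∀ {m} → ℕ → Vec ℕ m → Set where
  []  : ∀ {x} → Spaced x []
  _∷_ : ∀ {m x a} {A : Vec ℕ m} → x ≤ a → Spaced (2 + a) A → Spaced x (a ∷ A)

spaced⇒index : ∀ {m x} {A : Vec ℕ m} → Spaced x A → IsIndexSet A
spaced⇒index []                = []
spaced⇒index (_ ∷ [])          = [-]
spaced⇒index (_ ∷ h@(a<b ∷ _)) = a<b ∷ spaced⇒index h

index⇒spaced : ∀ {m} {A : Vec ℕ m} → IsIndexSet A → Spaced 0 A
index⇒spaced []  = []
index⇒spaced [-] = z≤n ∷ []
index⇒spaced (a<b ∷ L) with index⇒spaced L
... | _ ∷ h = z≤n ∷ (a<b ∷ h)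

-- `U` unrolled along the vector: `i` entries have been passed, so the head has the one-based index
-- `suc i`.
Covers : ∀ {m} → ℕ → Vec ℕ m → Pred Triple 0ℓ
Covers i []      t = ⊥
Covers i (a ∷ A) t = S a (suc i) t ⊎ Covers (suc i) A t

covers⁺ : ∀ {m} i (A : Vec ℕ m) {t} j → S (Vec.lookup A j) (suc (i + toℕ j)) t → Covers i A t
covers⁺ i (a ∷ A) {t} Fin.zero    s = inj₁ (subst (λ k → S a (suc k) t) (+-identityʳ i) s)
covers⁺ i (a ∷ A) {t} (Fin.suc j) s = inj₂ (covers⁺ (suc i) A j
  (subst (λ k → S (Vec.lookup A j) (suc k) t) (+-suc i (toℕ j)) s))

covers⁻ : ∀ {m} i (A : Vec ℕ m) {t} → Covers i A t → ∃[ j ] S (Vec.lookup A j) (suc (i + toℕ j)) t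
covers⁻ i (a ∷ A) {t} (inj₁ s) = Fin.zero , subst (λ k → S a (suc k) t) (sym (+-identityʳ i)) s
covers⁻ i (a ∷ A) {t} (inj₂ c) with covers⁻ (suc i) A c
... | j , s = Fin.suc j , subst (λ k → S (Vec.lookup A j) (suc k) t) (sym (+-suc i (toℕ j))) s

-- just (i + d) if p lies in none of the sets {a , a + 1} and above d of them.
depth : ∀ {m} → ℕ → Vec ℕ m → ℕ → Maybe ℕ
depth i []      p = just i
depth i (a ∷ A) p with p <? a | p ≤? suc a
... | yes _ | _     = just i
... | no _  | yes _ = nothing
... | no _  | no _  = depth (suc i) A p

Inside : Maybe ℕ → ℕ → ℕ → Set
Inside nothing  p u = ⊥
Inside (just d) p u = d < u × u ≤ p ∸ d

-- The values of `u` are peeled off from outside: each entry with `suc a < p` covers both ends of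
-- the interval from `suc i` to `p ∸ i` and passes the shorter interval on.
covers : ∀ {m} i (A : Vec ℕ m) {u p k} → i < u → u ≤ p ∸ i →
  ¬ Inside (depth i A p) p u → Covers i A (u , p , k)
covers i [] i<u u≤ ¬in = ⊥-elim (¬in (i<u , u≤))
covers i (a ∷ A) {u} {p} i<u u≤ ¬in with p <? a | p ≤? suc a
... | yes _  | _       = ⊥-elim (¬in (i<u , u≤))
... | no p≮a | yes p≤a = inj₁ (inj₁ (eq (m≤n⇒m<n∨m≡n (≮⇒≥ p≮a)) , i<u , u≤))
  where
  eq : a < p ⊎ a ≡ p → p ≡ a ⊎ p ≡ suc a
  eq (inj₁ a<p) = inj₂ (≤-antisym p≤a a<p)
  eq (inj₂ refl) = inj₁ refl
... | no _   | no p≰a with u ≟ suc i | u ≟ p ∸ i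
... | yes u≡ | _      = inj₁ (inj₂ (≰⇒> p≰a , inj₁ u≡))
... | no _   | yes u≡ = inj₁ (inj₂ (≰⇒> p≰a , inj₂ u≡))
... | no u≢  | no u≢′ = inj₂ (covers (suc i) A (≤∧≢⇒< i<u (u≢ ∘ sym))
  (≤-trans (<⇒≤pred (≤∧≢⇒< u≤ u≢′)) (≤-reflexive (pred[m∸n]≡m∸[1+n] p i))) ¬in)

inside-outer : ∀ {m} i (A : Vec ℕ m) {u p} → Inside (depth i A p) p u → i < u × u ≤ p ∸ i
inside-outer i [] h = h
inside-outer i (a ∷ A) {u} {p} h with p <? a | p ≤? suc a
... | yes _ | _    = h
... | no _  | no _ with inside-outer (suc i) A h
... | i<u , u≤ = <⇒≤ i<u , ≤-trans u≤ (∸-monoʳ-≤ p (n≤1+n i))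

¬covers-below : ∀ {m x} i {A : Vec ℕ m} {u p k} → Spaced x A → p < x → ¬ Covers i A (u , p , k)
¬covers-below i (x≤a ∷ h) p<x (inj₁ (inj₁ (inj₁ refl , _))) = <⇒≱ p<x x≤a
¬covers-below i (x≤a ∷ h) p<x (inj₁ (inj₁ (inj₂ refl , _))) = <⇒≱ p<x (m≤n⇒m≤1+n x≤a)
¬covers-below i (x≤a ∷ h) p<x (inj₁ (inj₂ (a<p , _))) = <-asym p<x (≤-<-trans x≤a (<⇒≤ a<p))
¬covers-below i (x≤a ∷ h) p<x (inj₂ c) = ¬covers-below (suc i) h (<-≤-trans p<x (≤-trans x≤a (m≤n+m _ 2))) c

≰pred : ∀ {v w} → w < v → ¬ v ≤ pred v
≰pred {suc v} _ = 1+n≰n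

-- By `inside-outer` the missed values stay away from the ends covered at each earlier step; entries
-- above `p` cover nothing of part `p`.
¬covers : ∀ {m x} i {A : Vec ℕ m} {u p k} → Spaced x A → Inside (depth i A p) p u → ¬ Covers i A (u , p , k)
¬covers i {a ∷ A} {u} {p} {k} (x≤a ∷ h) ins c with p <? a | p ≤? suc a
... | yes p<a | _     = ¬covers-below {x = a} i {A = a ∷ A} {u} {p} {k} (≤-refl ∷ h) p<a c
... | no _   | no p≰a with c | inside-outer (suc i) A ins
... | inj₁ (inj₁ (inj₁ refl , _)) | _ = p≰a (n≤1+n _)
... | inj₁ (inj₁ (inj₂ refl , _)) | _ = p≰a ≤-refl
... | inj₁ (inj₂ (_ , inj₁ refl)) | i<u , _ = <-irrefl refl i<u
... | inj₁ (inj₂ (_ , inj₂ refl)) | i<u , u≤ = ≰pred i<u (subst (u ≤_) (sym (pred[m∸n]≡m∸[1+n] p i)) u≤)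
... | inj₂ c′ | _ = ¬covers (suc i) h ins c′
-- The sets {a , a + 1} below `p` are disjoint, so `d` of them take up `2 * d` numbers below `p`.
-- Hence `p ∸ 2 * d` is not truncated and the two covered ends do not overlap.
depth-≤ : ∀ {m x d p} i {A : Vec ℕ m} → Spaced x A → 2 * i ≤ x → 2 * i ≤ p → depth i A p ≡ just d → 2 * d ≤ p
depth-≤ i [] i≤x i≤p refl = i≤p
depth-≤ {p = p} i {a ∷ A} (x≤a ∷ h) i≤x i≤p eq with p <? a | p ≤? suc a | eq
... | yes _ | _      | refl = i≤p
... | no _  | no p≰a | eq′  = depth-≤ (suc i) h 2i≤a (≤-trans 2i≤a (≰⇒> p≰a)) eq′
  where
  2i≤a : 2 * suc i ≤ 2 + a
  2i≤a = ≤-trans (≤-reflexive (*-suc 2 i)) (+-monoʳ-≤ 2 (≤-trans i≤x x≤a))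

missing : Maybe ℕ → ℕ → ℕ
missing nothing  p = 0
missing (just d) p = p ∸ 2 * d

rows : ℕ → List ℕ → List ℕ → List Triple
rows p us ks = map (λ (u , k) → u , p , k) (cartesianProduct us ks)

rows-++ : ∀ p us vs ks → rows p (us ++ vs) ks ≡ rows p us ks ++ rows p vs ks
rows-++ p us vs ks = trans (cong (map _) (cartesianProductWith-distribʳ-++ _,_ us vs ks)) (map-++ _ (cartesianProduct us ks) _)

length-rows : ∀ p us ks → length (rows p us ks) ≡ length us * length ks
length-rows p []       ks = refl
length-rows p (u ∷ us) ks = trans (cong length (map-++ _ (map (u ,_) ks) (cartesianProduct us ks)))
  (trans (length-++ (map _ (map (u ,_) ks)))
  (cong₂ _+_ (trans (length-map _ (map (u ,_) ks)) (length-map (u ,_) ks)) (length-rows p us ks)))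

all-rows : ∀ {Q : Pred Triple 0ℓ} {p us} ks → All (λ u → ∀ k → Q (u , p , k)) us → All Q (rows p us ks)
all-rows ks [] = []
all-rows {Q} {p} {u ∷ us} ks (h ∷ hs) = subst (All Q) (sym (map-++ _ (map (u ,_) ks) (cartesianProduct us ks)))
  (All.++⁺ (All.map⁺ (All.map⁺ (All.universal h ks))) (all-rows ks hs))

applyUpTo-+ : ∀ {B : Set} (f : ℕ → B) m n → applyUpTo f (m + n) ≡ applyUpTo f m ++ applyUpTo (f ∘ (m +_)) n
applyUpTo-+ f zero    n = refl
applyUpTo-+ f (suc m) n = cong (f 0 ∷_) (applyUpTo-+ (f ∘ suc) m n)

module _ {m} (A : Vec ℕ m) (spaced : Spaced 0 A) where

  u-covered : ∀ {u p} k → 0 < u → u ≤ p → ¬ Inside (depth 0 A p) p u → U A (u , p , k)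
  u-covered k 0<u u≤p ¬in = covers⁻ 0 A {_ , _ , k} (covers 0 A 0<u u≤p ¬in)

  u-uncovered : ∀ {u p} k → Inside (depth 0 A p) p u → ¬ U A (u , p , k)
  u-uncovered k ins (j , s) = ¬covers 0 {k = k} spaced ins (covers⁺ 0 A j s)

  private
    count : List Triple → ℕ
    count ts = length (filter (U? A) ts)

    count-++ : ∀ ts ts′ → count (ts ++ ts′) ≡ count ts + count ts′
    count-++ ts ts′ = trans (cong length (filter-++ (U? A) ts ts′)) (length-++ (filter (U? A) ts))

    count-rows-all : ∀ {p us} ks → All (λ u → ∀ k → U A (u , p , k)) us →
      count (rows p us ks) ≡ length us * length ks
    count-rows-all {p} {us} ks h = trans (cong length (filter-all (U? A) (all-rows ks h))) (length-rows p us ks)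

    count-rows-none : ∀ {p us} ks → All (λ u → ∀ k → ¬ U A (u , p , k)) us → count (rows p us ks) ≡ 0
    count-rows-none ks h = cong length (filter-none (U? A) (all-rows ks h))

  -- The values u = 1, …, p split into the d first ones, the d last ones, which
  -- are covered, and the p - 2 d other ones, which are not.
  count-rows : ∀ p ks → count (rows p [1⋯ p ] ks) + missing (depth 0 A p) p * length ks ≡ p * length ks
  count-rows p ks with depth 0 A p in eq
  ... | nothing = trans (+-identityʳ _)
    (trans (count-rows-all ks (All.map⁺ (All.applyUpTo⁺₁ id p λ i<p k →
      u-covered k (s≤s z≤n) i<p (subst (λ z → ¬ Inside z p _) (sym eq) λ ()))))
    (cong (_* length ks) (trans (length-map suc (upTo p)) (length-upTo p))))
  ... | just d = begin
    count (rows p [1⋯ p ] ks) + c * l                                ≡⟨ cong (λ us → count (rows p us ks) + c * l) split ⟩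
    count (rows p (low ++ mid ++ high) ks) + c * l                   ≡⟨ cong (λ ts → count ts + c * l) (trans (rows-++ p low _ ks) (cong (rows p low ks ++_) (rows-++ p mid high ks))) ⟩
    count (rows p low ks ++ rows p mid ks ++ rows p high ks) + c * l ≡⟨ cong (_+ c * l) (trans (count-++ (rows p low ks) _) (cong (count (rows p low ks) +_) (count-++ (rows p mid ks) _))) ⟩
    count (rows p low ks) + (count (rows p mid ks) + count (rows p high ks)) + c * l
      ≡⟨ cong (_+ c * l) (cong₂ _+_ (trans (count-rows-all ks low-all) (cong (_* l) (length-applyUpTo suc d)))
          (cong₂ _+_ (count-rows-none ks mid-none) (trans (count-rows-all ks high-all) (cong (_* l) (length-applyUpTo _ d))))) ⟩
    d * l + d * l + c * l                                            ≡⟨ trans (+-assoc (d * l) _ _) (cong (d * l +_) (trans (+-comm (d * l) _) (sym (*-distribʳ-+ l c d)))) ⟩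
    d * l + (c + d) * l                                              ≡⟨ *-distribʳ-+ l d (c + d) ⟨
    (d + (c + d)) * l                                                ≡⟨ cong (_* l) p≡ ⟨
    p * l                                                            ∎
    where
    open ≡-Reasoning
    c = p ∸ 2 * d
    l = length ks
    p≡ : p ≡ d + (c + d)
    p≡ = begin
      p                    ≡⟨ m+[n∸m]≡n (depth-≤ 0 spaced z≤n z≤n eq) ⟨
      d + (d + 0) + c      ≡⟨ cong (λ z → d + z + c) (+-identityʳ d) ⟩
      d + d + c            ≡⟨ trans (+-assoc d d c) (cong (d +_) (+-comm d c)) ⟩
      d + (c + d)          ∎
    p∸d≡ : p ∸ d ≡ d + c
    p∸d≡ = trans (cong (_∸ d) p≡) (trans (m+n∸m≡n d (c + d)) (+-comm c d))
    low  = applyUpTo suc d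
    mid  = applyUpTo (λ k → suc (d + k)) c
    high = applyUpTo (λ k → suc (d + (c + k))) d
    split : [1⋯ p ] ≡ low ++ mid ++ high
    split = trans (map-applyUpTo id suc p) (trans (cong (applyUpTo suc) p≡)
      (trans (applyUpTo-+ suc d (c + d)) (cong (low ++_) (applyUpTo-+ (λ k → suc (d + k)) c d))))
    low-all : All (λ u → ∀ k → U A (u , p , k)) low
    low-all = All.applyUpTo⁺₁ suc d λ i<d k → u-covered k (s≤s z≤n)
      (≤-trans i<d (≤-trans (m≤m+n d _) (≤-reflexive (sym p≡))))
      (subst (λ z → ¬ Inside z p _) (sym eq) λ (d<u , _) → <⇒≱ d<u i<d)
    mid-none : All (λ u → ∀ k → ¬ U A (u , p , k)) mid
    mid-none = All.applyUpTo⁺₁ _ c λ {i} i<c k → u-uncovered k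
      (subst (λ z → Inside z p _) (sym eq) (s≤s (m≤m+n d i) ,
        ≤-trans (≤-reflexive (sym (+-suc d i))) (≤-trans (+-monoʳ-≤ d i<c) (≤-reflexive (sym p∸d≡)))))
    high-all : All (λ u → ∀ k → U A (u , p , k)) high
    high-all = All.applyUpTo⁺₁ _ d λ {i} i<d k → u-covered k (s≤s z≤n)
      (≤-trans (≤-reflexive (trans (sym (+-suc d (c + i))) (cong (d +_) (sym (+-suc c i)))))
        (≤-trans (+-monoʳ-≤ d (+-monoʳ-≤ c i<d)) (≤-reflexive (sym p≡))))
      (subst (λ z → ¬ Inside z p (suc (d + (c + i)))) (sym eq) λ (_ , u≤) →
        <⇒≱ (s≤s (≤-trans (m≤m+n (d + c) i) (≤-reflexive (+-assoc d c i)))) (≤-trans u≤ (≤-reflexive p∸d≡)))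

-- Missed elements as the cost of a tiling

weighted : (ℕ → ℕ) → List Block → ℕ
weighted f []             = 0
weighted f ((p , n) ∷ bs) = f p * n + weighted f bs

loss : ∀ {m} → ℕ → Vec ℕ m → ℕ → ℕ
loss i A p = missing (depth i A p) p

∣U∣-loss : ∀ {m} (A : Vec ℕ m) → Spaced 0 A → ∀ P →
  ∣U∣ P A + weighted (loss 0 A) (blocks P) ≡ sum (map (uncurry _*_) (blocks P))
∣U∣-loss A spaced P = go (blocks P)
  where
  open ≡-Reasoning
  count : List Triple → ℕ
  count ts = length (filter (U? A) ts)
  element : Block → List Triple
  element (p , n) = rows p [1⋯ p ] [1⋯ n ]
  length-[1⋯] : ∀ n → length [1⋯ n ] ≡ n
  length-[1⋯] n = trans (length-map suc (upTo n)) (length-upTo n)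
  go : ∀ bs → count (concatMap element bs) + weighted (loss 0 A) bs ≡ sum (map (uncurry _*_) bs)
  go []             = refl
  go ((p , n) ∷ bs) = begin
    count (element (p , n) ++ concatMap element bs) + (loss 0 A p * n + weighted (loss 0 A) bs)
      ≡⟨ cong (_+ _) (trans (cong length (filter-++ (U? A) (element (p , n)) _)) (length-++ (filter (U? A) (element (p , n))))) ⟩
    count (element (p , n)) + count (concatMap element bs) + (loss 0 A p * n + weighted (loss 0 A) bs)
      ≡⟨ interchange (count (element (p , n))) (count (concatMap element bs)) (loss 0 A p * n) _ ⟩
    count (element (p , n)) + loss 0 A p * n + (count (concatMap element bs) + weighted (loss 0 A) bs)
      ≡⟨ cong₂ _+_ (subst (λ l → count (element (p , n)) + loss 0 A p * l ≡ p * l) (length-[1⋯] n) (count-rows A spaced p [1⋯ n ])) (go bs) ⟩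
    p * n + sum (map (uncurry _*_) bs) ∎
    where
    interchange : ∀ a b c d → a + b + (c + d) ≡ a + c + (b + d)
    interchange = solve-∀

wsum : ℕ → (ℕ → ℕ) → List ℕ → ℕ
wsum x f []       = 0
wsum x f (w ∷ ws) = f x * w + wsum (suc x) f ws

wsum-cong : ∀ {f g} x ws → (∀ {y} → x ≤ y → f y ≡ g y) → wsum x f ws ≡ wsum x g ws
wsum-cong x []       h = refl
wsum-cong x (w ∷ ws) h = cong₂ _+_ (cong (_* w) (h ≤-refl)) (wsum-cong (suc x) ws (h ∘ <⇒≤))

-- After `i` dominoes and `R` uncovered entries the position is `R + 2 * i`. The number of missed
-- values of `u` there is the index that the entry gets in the remaining list, which is its weight
-- in `cost`.
loss-below : ∀ {m} i R (A : Vec ℕ m) → Spaced (suc (R + 2 * i)) A → loss i A (R + 2 * i) ≡ R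
loss-below i R [] h = m+n∸n≡m R (2 * i)
loss-below i R (a ∷ A) (x<a ∷ _) with R + 2 * i <? a
... | yes _  = m+n∸n≡m R (2 * i)
... | no x≮a = contradiction x<a x≮a

loss-at : ∀ {m p} i a (A : Vec ℕ m) → a ≤ p → p ≤ suc a → loss i (a ∷ A) p ≡ 0
loss-at {p = p} i a A a≤p p≤a with p <? a | p ≤? suc a
... | yes p<a | _      = contradiction a≤p (<⇒≱ p<a)
... | no _    | yes _  = refl
... | no _    | no p≰a = contradiction p≤a p≰a

loss-above : ∀ {m p} i a (A : Vec ℕ m) → suc a < p → loss i (a ∷ A) p ≡ loss (suc i) A p
loss-above {p = p} i a A a<p with p <? a | p ≤? suc a
... | yes p<a | _       = contradiction (<⇒≤ a<p) (<⇒≱ (m<n⇒m<1+n p<a))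
... | no _    | yes p≤a = contradiction p≤a (<⇒≱ a<p)
... | no _    | no _    = refl

wsum-skip : ∀ {m} i R (A : Vec ℕ m) w ws rs → Spaced (suc (R + 2 * i)) A →
  wsum (suc (R + 2 * i)) (loss i A) ws ≡ cost (suc R) rs →
  wsum (R + 2 * i) (loss i A) (w ∷ ws) ≡ cost R (w ∷ rs)
wsum-skip i R A w ws rs h eq = cong₂ _+_ (cong (_* w) (loss-below i R A h)) eq

wsum-domino : ∀ {m} i a (A : Vec ℕ m) w w′ ws →
  wsum a (loss i (a ∷ A)) (w ∷ w′ ∷ ws) ≡ wsum (2 + a) (loss (suc i) A) ws
wsum-domino i a A w w′ ws
  rewrite loss-at i a A ≤-refl (n≤1+n a) | loss-at i a A (n≤1+n a) ≤-refl =
  wsum-cong (2 + a) ws (loss-above i a A)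

+-2*-suc : ∀ R i → R + 2 * suc i ≡ 2 + (R + 2 * i)
+-2*-suc = solve-∀

-- The vector is read off along the line; entries beyond the end become dominoes that `done` leaves
-- unplaced.
index⇒tiling : ∀ ws {m} i R (A : Vec ℕ m) → Spaced (R + 2 * i) A →
  ∃[ rs ] Tiling ws rs m × wsum (R + 2 * i) (loss i A) ws ≡ cost R rs
index⇒tiling [] i R A h = [] , done , refl
index⇒tiling (w ∷ ws) i R [] h with index⇒tiling ws i (suc R) [] []
... | rs , T , eq = w ∷ rs , skip T , wsum-skip i R [] w ws rs [] eq
index⇒tiling (w ∷ ws) i R (a ∷ A) (x≤a ∷ h) with m≤n⇒m<n∨m≡n x≤a
... | inj₁ x<a with index⇒tiling ws i (suc R) (a ∷ A) (x<a ∷ h)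
... | rs , T , eq = w ∷ rs , skip T , wsum-skip i R (a ∷ A) w ws rs (x<a ∷ h) eq
index⇒tiling (w ∷ []) i R (a ∷ A) (_ ∷ h) | inj₂ refl = [] , half ,
  trans (+-identityʳ _) (cong (_* w) (loss-at i a A ≤-refl (n≤1+n a)))
index⇒tiling (w ∷ w′ ∷ ws) i R (a ∷ A) (_ ∷ h) | inj₂ refl
  with index⇒tiling ws (suc i) R A (subst (λ x → Spaced x A) (sym (+-2*-suc R i)) h)
... | rs , T , eq = rs , domino T ,
  trans (wsum-domino i a A w w′ ws) (trans (cong (λ x → wsum x (loss (suc i) A) ws) (sym (+-2*-suc R i))) eq)

-- Supplies vector entries for the dominoes beyond the end of the list.
far : ∀ m x → ∃[ A ] Spaced {m} x A
far zero    x = [] , []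
far (suc m) x = let A , h = far m (2 + x) in x ∷ A , ≤-refl ∷ h

spaced-≤ : ∀ {m x y} {A : Vec ℕ m} → x ≤ y → Spaced y A → Spaced x A
spaced-≤ x≤y []        = []
spaced-≤ x≤y (y≤a ∷ h) = ≤-trans x≤y y≤a ∷ h

tiling⇒index : ∀ {ws rs m} i R → Tiling ws rs m →
  ∃[ A ] Spaced {m} (R + 2 * i) A × wsum (R + 2 * i) (loss i A) ws ≡ cost R rs
tiling⇒index {m = m} i R done = let A , h = far m (R + 2 * i) in A , h , refl
tiling⇒index {m = suc m} i R (half {w}) = let A , h = far m (2 + (R + 2 * i)) in
  (R + 2 * i) ∷ A , ≤-refl ∷ h ,
  trans (+-identityʳ _) (cong (_* w) (loss-at i (R + 2 * i) A ≤-refl (n≤1+n (R + 2 * i))))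
tiling⇒index i R (skip {w} {ws} {rs} T) with tiling⇒index i (suc R) T
... | A , h , eq = A , spaced-≤ (n≤1+n _) h , wsum-skip i R A w ws rs h eq
tiling⇒index i R (domino {w} {w′} {ws} T) with tiling⇒index (suc i) R T
... | A , h , eq = (R + 2 * i) ∷ A , ≤-refl ∷ subst (λ x → Spaced x A) (+-2*-suc R i) h ,
  trans (wsum-domino i (R + 2 * i) A w w′ ws) (trans (cong (λ x → wsum x (loss (suc i) A) ws) (sym (+-2*-suc R i))) eq)

-- The terms of μ

even-step : ∀ a b ns j → (a ∷ b ∷ ns) ‼ (2 * suc (suc j)) ≡ ns ‼ (2 * suc j)
even-step a b ns j = trans (cong ((a ∷ b ∷ ns) ‼_) (*-suc 2 (suc j)))
  (trans (cong (λ k → (a ∷ b ∷ ns) ‼ (2 + k)) (*-suc 2 j)) (cong (ns ‼_) (sym (*-suc 2 j))))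

odd-step : ∀ a b ns i → (a ∷ b ∷ ns) ‼ (2 * suc (suc i) ∸ 1) ≡ ns ‼ (2 * suc i ∸ 1)
odd-step a b ns i = trans (cong (λ k → (a ∷ b ∷ ns) ‼ (k ∸ 1)) (*-suc 2 (suc i)))
  (trans (cong (λ k → (a ∷ b ∷ ns) ‼ (1 + k)) (*-suc 2 i)) (cong (λ k → ns ‼ (k ∸ 1)) (sym (*-suc 2 i))))

evenEntry⁺ : ∀ ns j → j < ⌈ length ns /2⌉ → EvenEntry ns (ns ‼ (2 * suc j))
-- `‼` gives 0 beyond the end, which is the value n_{s+1} = 0.
evenEntry⁺ (a ∷ [])     zero    j<       = pad
evenEntry⁺ (a ∷ [])     (suc j) (s≤s ())
evenEntry⁺ (a ∷ b ∷ ns) zero    j<       = here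
evenEntry⁺ (a ∷ b ∷ ns) (suc j) (s≤s j<) =
  there (subst (EvenEntry ns) (sym (even-step a b ns j)) (evenEntry⁺ ns j j<))

evenEntry⁻ : ∀ {ns e} → EvenEntry ns e → ∃[ j ] j < ⌈ length ns /2⌉ × ns ‼ (2 * suc j) ≡ e
evenEntry⁻ pad  = 0 , s≤s z≤n , refl
evenEntry⁻ here = 0 , s≤s z≤n , refl
evenEntry⁻ (there {a} {b} {ns} E) with evenEntry⁻ E
... | j , j< , eq = suc j , s≤s j< , trans (even-step a b ns j) eq

oddEven⁺ : ∀ ns i j → i ≤ j → j < ⌈ length ns /2⌉ → OddEven ns (ns ‼ (2 * suc i ∸ 1)) (ns ‼ (2 * suc j))
oddEven⁺ (a ∷ ns)     zero    j       i≤j       j<       = here (evenEntry⁺ (a ∷ ns) j j<)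
oddEven⁺ (a ∷ b ∷ ns) (suc i) (suc j) (s≤s i≤j) (s≤s j<) =
  there (subst₂ (OddEven ns) (sym (odd-step a b ns i)) (sym (even-step a b ns j)) (oddEven⁺ ns i j i≤j j<))

oddEven⁻ : ∀ {ns o e} → OddEven ns o e →
  ∃[ i ] ∃[ j ] i ≤ j × j < ⌈ length ns /2⌉ × ns ‼ (2 * suc i ∸ 1) ≡ o × ns ‼ (2 * suc j) ≡ e
oddEven⁻ (here E) with evenEntry⁻ E
... | j , j< , eq = 0 , j , z≤n , j< , refl , eq
oddEven⁻ (there {a} {b} {ns} E) with oddEven⁻ E
... | i , j , i≤j , j< , eqo , eqe = suc i , suc j , s≤s i≤j , s≤s j< ,
  trans (odd-step a b ns i) eqo , trans (even-step a b ns j) eqe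

spreadTerm : ℕ → List ℕ → ℕ × ℕ → ℕ
spreadTerm p ns (i , j) = p * (ns ‼ (2 * i ∸ 1)) + (p + 1) * (ns ‼ (2 * j))

spreadTerms : ℕ → List ℕ → ℕ → List ℕ
spreadTerms p ns h = map (spreadTerm p ns)
  (filter (λ (i , j) → i ≤? j) (cartesianProduct [1⋯ h ] [1⋯ h ]))

spreadTerms⁺ : ∀ {p ns o e} → OddEven ns o e → p * o + suc p * e ∈ spreadTerms p ns ⌈ length ns /2⌉
spreadTerms⁺ {p} {ns} E with oddEven⁻ E
... | i , j , i≤j , j< , refl , refl = subst (λ k → p * (ns ‼ (2 * suc i ∸ 1)) + k * (ns ‼ (2 * suc j)) ∈ spreadTerms p ns ⌈ length ns /2⌉) (+-comm p 1)
  (∈-map⁺ (spreadTerm p ns) (∈-filter⁺ (λ (i , j) → i ≤? j)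
    (∈-cartesianProduct⁺ (∈-map⁺ suc (∈-upTo⁺ (≤-<-trans i≤j j<))) (∈-map⁺ suc (∈-upTo⁺ j<))) (s≤s i≤j)))

spreadTerms⁻ : ∀ {p ns t} → t ∈ spreadTerms p ns ⌈ length ns /2⌉ →
  ∃[ o ] ∃[ e ] OddEven ns o e × t ≡ p * o + suc p * e
spreadTerms⁻ {p} {ns} t∈ with ∈-map⁻ (spreadTerm p ns) t∈
... | (i , j) , ij∈ , refl with ∈-filter⁻ (λ (i , j) → i ≤? j) {xs = cartesianProduct [1⋯ ⌈ length ns /2⌉ ] [1⋯ ⌈ length ns /2⌉ ]} ij∈
... | ij∈′ , i≤j with ∈-cartesianProduct⁻ [1⋯ ⌈ length ns /2⌉ ] [1⋯ ⌈ length ns /2⌉ ] ij∈′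
... | i∈ , j∈ with ∈-map⁻ suc i∈ | ∈-map⁻ suc j∈
... | i′ , _ , refl | j′ , j′∈ , refl = _ , _ , oddEven⁺ ns i′ j′ (s≤s⁻¹ i≤j) (∈-upTo⁻ j′∈) ,
  cong (λ k → p * (ns ‼ (2 * suc i′ ∸ 1)) + k * (ns ‼ (2 * suc j′))) (+-comm p 1)

-- Reduced spreads and their positions

consec⁺ : ℕ → List⁺ ℕ → Spread
consec⁺ p (n ∷ ns) = (p , n) ∷ consec (suc p) ns

multiplicities : ∀ p ns → map proj₂ (consec p ns) ≡ ns
multiplicities p []       = refl
multiplicities p (n ∷ ns) = cong (n ∷_) (multiplicities (suc p) ns)

μ-consec : ∀ p ns → All (1 ≤_) (toList ns) →
  μ-spread (consec⁺ p ns) ≡ minimum (spreadTerms p (toList ns) ⌈ length (toList ns) /2⌉)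
μ-consec p (n ∷ ns) h = cong₂ (λ ks l → minimum (spreadTerms p ks l))
  (multiplicities p (n ∷ ns)) (r-consec p (n ∷ ns) h)

consec-∸ : ∀ c p ns → map (λ (q , n) → q ∸ c , n) (consec (p + c) ns) ≡ consec p ns
consec-∸ c p []       = refl
consec-∸ c p (n ∷ ns) = cong₂ _∷_ (cong (_, n) (m+n∸n≡m p c)) (consec-∸ c (suc p) ns)

consec⁺-∸ : ∀ c p ns → consec⁺ (p + c) ns -ˢ c ≡ consec⁺ p ns
consec⁺-∸ c p (n ∷ ns) = cong₂ _∷_ (cong (_, n) (m+n∸n≡m p c)) (consec-∸ c (suc p) ns)

-- `x` is the position right behind the previous spread (0 at the start). It carries multiplicity 0,
-- so the next spread starts at `suc x` or later.
data Placed : ℕ → List Spread → List Run → Set where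
  []  : ∀ {x} → Placed x [] []
  run : ∀ {x g p ns Qs runs} → p ≡ suc (x + g) → All (1 ≤_) (toList ns) →
    Placed (p + length (toList ns)) Qs runs → Placed x (consec⁺ p ns ∷ Qs) ((g , ns) ∷ runs)

after-length : ∀ p ns → 1 ≤ p → after p ns + 2 * ⌈ length ns /2⌉ ≡ p + length ns
after-length p []           1≤p = refl
after-length (suc p) (_ ∷ [])     1≤p = +-suc p 1
after-length p (_ ∷ _ ∷ ns) 1≤p = begin
  after p ns + 2 * suc ⌈ length ns /2⌉     ≡⟨ lemma (after p ns) ⌈ length ns /2⌉ ⟩
  2 + (after p ns + 2 * ⌈ length ns /2⌉)   ≡⟨ cong (2 +_) (after-length p ns 1≤p) ⟩
  2 + (p + length ns)                      ≡⟨ lemma′ p (length ns) ⟩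
  p + (2 + length ns)                      ∎
  where
  open ≡-Reasoning
  lemma : ∀ a h → a + 2 * suc h ≡ 2 + (a + 2 * h)
  lemma = solve-∀
  lemma′ : ∀ a h → 2 + (a + h) ≡ a + (2 + h)
  lemma′ = solve-∀

module _ (b r̄ : ℕ) {x g : ℕ} {ns : List⁺ ℕ} (h : All (1 ≤_) (toList ns)) (eq : x ≡ b + 2 * r̄) where

  private
    p = suc (b + g)

  position : suc (x + g) ≡ p + 2 * r̄
  position = trans (cong (λ y → suc (y + g)) eq) (lemma b (2 * r̄) g)
    where
    lemma : ∀ b c g → suc (b + c + g) ≡ suc (b + g) + c
    lemma = solve-∀

  reduced-head : consec⁺ (suc (x + g)) ns -ˢ (2 * r̄) ≡ consec⁺ p ns
  reduced-head = trans (cong (λ q → consec⁺ q ns -ˢ (2 * r̄)) position) (consec⁺-∸ (2 * r̄) p ns)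

  μ-head : μ-spread (consec⁺ (suc (x + g)) ns -ˢ (2 * r̄)) ≡ minimum (spreadTerms p (toList ns) ⌈ length (toList ns) /2⌉)
  μ-head = trans (cong μ-spread reduced-head) (μ-consec p ns h)

  -- Passes the invariant `x ≡ b + 2 * r̄` on to the next spread.
  next : suc (x + g) + length (toList ns) ≡ after p (toList ns) + 2 * (r̄ + r (toList (consec⁺ (suc (x + g)) ns)))
  next = begin
    suc (x + g) + l                     ≡⟨ cong (_+ l) position ⟩
    p + 2 * r̄ + l                       ≡⟨ lemma p (2 * r̄) l ⟩
    p + l + 2 * r̄                       ≡⟨ cong (_+ 2 * r̄) (after-length p (toList ns) (s≤s z≤n)) ⟨
    after p (toList ns) + 2 * ⌈ l /2⌉ + 2 * r̄        ≡⟨ lemma′ (after p (toList ns)) ⌈ l /2⌉ r̄ ⟩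
    after p (toList ns) + 2 * (r̄ + ⌈ l /2⌉)          ≡⟨ cong (λ k → after p (toList ns) + 2 * (r̄ + k)) (r-consec (suc (x + g)) (toList ns) h) ⟨
    after p (toList ns) + 2 * (r̄ + r (toList (consec⁺ (suc (x + g)) ns)))  ∎
    where
    open ≡-Reasoning
    l = length (toList ns)
    lemma : ∀ a b c → a + b + c ≡ a + c + b
    lemma = solve-∀
    lemma′ : ∀ a b c → a + 2 * b + 2 * c ≡ a + 2 * (c + b)
    lemma′ = solve-∀

first-pair : ∀ (ns : List⁺ ℕ) → ∃[ o ] ∃[ e ] OddEven (toList ns) o e
first-pair (a ∷ [])     = _ , _ , here pad
first-pair (a ∷ b ∷ ns) = _ , _ , here here

reduced⁻ : ∀ {b r̄ x Qs runs t} → Placed x Qs runs → x ≡ b + 2 * r̄ →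
  t ∈ map μ-spread (reduced r̄ Qs) → Term b runs t
reduced⁻ {b} {r̄} (run {g = g} {ns = ns} refl h D) eq (here refl) =
  let _ , _ , E = first-pair ns
      o , e , E′ , t≡ = spreadTerms⁻ {suc (b + g)} {toList ns} (minimum-∈ (spreadTerms⁺ {suc (b + g)} E))
  in subst (λ t → Term b _ t) (sym (trans (μ-head b r̄ h eq) t≡)) (Term.here E′)
reduced⁻ {b} {r̄} (run refl h D) eq (there t∈) = Term.there (reduced⁻ D (next b r̄ h eq) t∈)

-- Only an inequality, since the list contains just the least term of each spread.
reduced⁺ : ∀ {b r̄ x Qs runs t} → Placed x Qs runs → x ≡ b + 2 * r̄ →
  Term b runs t → ∃[ t′ ] t′ ∈ map μ-spread (reduced r̄ Qs) × t′ ≤ t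
reduced⁺ {b} {r̄} (run {g = g} refl h D) eq (Term.here E) = _ , here refl ,
  ≤-trans (≤-reflexive (μ-head b r̄ h eq)) (minimum-≤ (spreadTerms⁺ {suc (b + g)} E))
reduced⁺ {b} {r̄} (run refl h D) eq (Term.there τ) with reduced⁺ D (next b r̄ h eq) τ
... | t′ , t′∈ , t′≤t = t′ , there t′∈ , t′≤t

odd-positive : ∀ {ns o e} → All (1 ≤_) ns → OddEven ns o e → 1 ≤ o
odd-positive (1≤a ∷ _) (here _)      = 1≤a
odd-positive (_ ∷ _ ∷ h) (there E) = odd-positive h E

term-positive : ∀ {x Qs b runs t} → Placed x Qs runs → Term b runs t → 1 ≤ t
term-positive (run _ h D) (Term.here E) =
  ≤-trans (odd-positive h E) (≤-trans (m≤m+n _ _) (m≤m+n _ _))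
term-positive (run _ h D) (Term.there τ) = term-positive D τ

-- From the blocks of a partition to runs

data Above : ℕ → List Block → Set where
  []  : ∀ {x} → Above x []
  _∷_ : ∀ {x p n bs} → x < p × 1 ≤ n → Above p bs → Above x ((p , n) ∷ bs)

above : ∀ {x p n bs} → x < p → Linked (λ b c → proj₁ b < proj₁ c) ((p , n) ∷ bs) →
  All (λ b → 1 ≤ proj₁ b × 1 ≤ proj₂ b) ((p , n) ∷ bs) → Above x ((p , n) ∷ bs)
above x<p [-]       ((_ , 1≤n) ∷ [])         = (x<p , 1≤n) ∷ []
above x<p (p<q ∷ L) ((_ , 1≤n) ∷ h) = (x<p , 1≤n) ∷ above p<q L h

partition-above : ∀ P → Above 0 (blocks P)
partition-above P with blocks P | increasing P | positive P
... | []     | L | h = []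
... | b ∷ bs | L | h@((1≤p , _) ∷ _) = above 1≤p L h

wsum-zeros : ∀ x f g ws → wsum x f (replicate g 0 ++ ws) ≡ wsum (x + g) f ws
wsum-zeros x f zero    ws = cong (λ y → wsum y f ws) (sym (+-identityʳ x))
wsum-zeros x f (suc g) ws = trans (cong (_+ wsum (suc x) f (replicate g 0 ++ ws)) (*-zeroʳ (f x)))
  (trans (wsum-zeros (suc x) f g ws) (cong (λ y → wsum y f ws) (sym (+-suc x g))))

-- The sums agree for all `f`, to be used both for `id`, giving the size of the partition, and for
-- `loss 0 A`.
Runs : ℕ → List Block → List Spread → Set
Runs x bs Qs = ∃[ runs ] Placed x Qs runs × (∀ f → wsum x f (line runs) ≡ weighted f bs)

≡ᵇ-refl : ∀ m → (m ≡ᵇ m) ≡ true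
≡ᵇ-refl zero    = refl
≡ᵇ-refl (suc m) = ≡ᵇ-refl m

m+1+k≢ᵇm : ∀ m k → (m + suc k ≡ᵇ m) ≡ false
m+1+k≢ᵇm zero    k = refl
m+1+k≢ᵇm (suc m) k = m+1+k≢ᵇm m k

attach-run : ∀ {x bs} p n Qs → x < p → 1 ≤ n → Runs p bs Qs → Runs x ((p , n) ∷ bs) (attach (p , n) Qs)
attach-run {x} {bs} p n Qs x<p 1≤n (runs , D , sums) = go D sums
  where
  g = p ∸ suc x
  p≡ : p ≡ suc (x + g)
  p≡ = sym (m+[n∸m]≡n x<p)
  line-sum : ∀ f ws → wsum (suc p) f ws ≡ weighted f bs →
    wsum x f (0 ∷ replicate g 0 ++ n ∷ ws) ≡ weighted f ((p , n) ∷ bs)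
  line-sum f ws eq = trans (wsum-zeros x f (suc g) (n ∷ ws))
    (trans (cong (λ y → wsum y f (n ∷ ws)) (trans (+-suc x g) (sym p≡)))
      (cong (f p * n +_) eq))
  -- The line of the larger parts starts with a zero at position `p`, whose place `n` takes.
  drop-zero : ∀ f ws → wsum p f (0 ∷ ws) ≡ weighted f bs → wsum (suc p) f ws ≡ weighted f bs
  drop-zero f ws = trans (cong (_+ wsum (suc p) f ws) (sym (*-zeroʳ (f p))))
  go : ∀ {Qs runs} → Placed p Qs runs → (∀ f → wsum p f (line runs) ≡ weighted f bs) →
    Runs x ((p , n) ∷ bs) (attach (p , n) Qs)
  go [] sums = (g , n ∷ []) ∷ [] , run p≡ (1≤n ∷ []) [] , λ f → line-sum f [] (sums f)
  go (run {g = zero} {ns = n′ ∷ ns} {Qs} {runs} refl h D) sums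
    rewrite +-identityʳ p | ≡ᵇ-refl p =
    (g , n ∷ n′ ∷ ns) ∷ runs ,
    run p≡ (1≤n ∷ h) (subst (λ y → Placed y Qs runs) (sym (+-suc p (suc (length ns)))) D) ,
    λ f → line-sum f (n′ ∷ ns ++ line runs) (drop-zero f (n′ ∷ ns ++ line runs) (sums f))
  -- The position behind `p` becomes the leading zero of the next run, so that run's gap shrinks by
  -- one.
  go (run {g = suc g′} {ns = n′ ∷ ns} {Qs} {runs} refl h D) sums
    rewrite m+1+k≢ᵇm p g′ =
    (g , n ∷ []) ∷ (g′ , n′ ∷ ns) ∷ runs ,
    run p≡ (1≤n ∷ []) (run (shift-gap p g′) h D) ,
    λ f → line-sum f ws (drop-zero f ws (sums f))
    where
    ws = 0 ∷ replicate g′ 0 ++ n′ ∷ ns ++ line runs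
    shift-gap : ∀ p g → suc (p + suc g) ≡ suc (p + 1 + g)
    shift-gap = solve-∀

spreads-runs : ∀ {x bs} → Above x bs → Runs x bs (spreads bs)
spreads-runs []                = [] , [] , λ f → refl
spreads-runs (_∷_ {bs = bs} (x<p , 1≤n) h) = attach-run {bs = bs} _ _ _ x<p 1≤n (spreads-runs h)

-- The differences of u

u-isMaximum : ∀ P k → IsMaximum (UChainCardinality P k) (u P k)
u-isMaximum P (suc k) = proj₂ (u-max P (suc k))
u-isMaximum P zero = ([] , [] , empty) , λ { _ ([] , _ , refl) → ≤-reflexive empty }
  where
  empty : ∣U∣ P [] ≡ 0
  empty = cong length (filter-none (U? []) (All.universal (λ _ ()) (𝒟 P)))

weighted-id : ∀ bs → weighted id bs ≡ sum (map (uncurry _*_) bs)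
weighted-id []             = refl
weighted-id ((p , n) ∷ bs) = cong (p * n +_) (weighted-id bs)

some-term : ∀ runs {n} → 1 ≤ n → wsum 0 id (line runs) ≡ n → ∃[ t ] Term 0 runs t
some-term []                () refl
some-term ((g , ns) ∷ runs) _ _ = _ , Term.here (proj₂ (proj₂ (first-pair ns)))

module _ {n} (P : Partition) (P⊢n : P ⊢ n) where

  private
    runs : List Run
    runs = proj₁ (spreads-runs (partition-above P))

    placed : Placed 0 (spreads (blocks P)) runs
    placed = proj₁ (proj₂ (spreads-runs (partition-above P)))

    line-sum : ∀ f → wsum 0 f (line runs) ≡ weighted f (blocks P)
    line-sum = proj₂ (proj₂ (spreads-runs (partition-above P)))

  μ-≤ : ∀ {t} → Term 0 runs t → μ P ≤ t
  μ-≤ τ = let _ , t′∈ , t′≤t = reduced⁺ {r̄ = 0} placed refl τ in ≤-trans (minimum-≤ t′∈) t′≤t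

  μ-term : 1 ≤ n → Term 0 runs (μ P)
  μ-term 1≤n =
    let _ , τ = some-term runs 1≤n (trans (line-sum id) (trans (weighted-id (blocks P)) P⊢n))
        _ , t′∈ , _ = reduced⁺ {r̄ = 0} placed refl τ
    in reduced⁻ {r̄ = 0} placed refl (minimum-∈ t′∈)

  μ-positive : 1 ≤ n → 1 ≤ μ P
  μ-positive 1≤n = term-positive placed (μ-term 1≤n)

  ∣U∣-cost : ∀ {k} {A : Vec ℕ k} {rs} → Spaced 0 A →
    wsum 0 (loss 0 A) (line runs) ≡ cost 0 rs → ∣U∣ P A + cost 0 rs ≡ n
  ∣U∣-cost {A = A} h eq = trans (cong (∣U∣ P A +_) (trans (sym eq) (line-sum (loss 0 A))))
    (trans (∣U∣-loss A h P) P⊢n)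

  -- Together with `u-tiling` this makes `n ∸ u P k` the least cost of a tiling with `k` dominoes.
  u-lower : ∀ {k rs} → Tiling (line runs) rs k → n ≤ u P k + cost 0 rs
  u-lower {k} {rs} T with tiling⇒index 0 0 T
  ... | A , h , eq = ≤-trans (≤-reflexive (sym (∣U∣-cost {rs = rs} h eq)))
    (+-monoˡ-≤ (cost 0 rs) (proj₂ (u-isMaximum P k) _ (A , spaced⇒index h , refl)))

  u-tiling : ∀ k → ∃[ rs ] Tiling (line runs) rs k × u P k + cost 0 rs ≡ n
  u-tiling k with proj₁ (u-isMaximum P k)
  ... | A , L , ∣U∣≡u with index⇒tiling (line runs) 0 0 A (index⇒spaced L)
  ... | rs , T , eq = rs , T , trans (cong (_+ cost 0 rs) (sym ∣U∣≡u)) (∣U∣-cost {rs = rs} (index⇒spaced L) eq)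

  u-≤ : ∀ k → u P k ≤ n
  u-≤ k with u-tiling k
  ... | rs , _ , eq = ≤-trans (m≤m+n (u P k) (cost 0 rs)) (≤-reflexive eq)

  u-full : ∀ {k} → need runs ≤ k → u P k ≡ n
  u-full {k} r≤k with greedy runs
  ... | rs , T , z = ≤-antisym (u-≤ k) (≤-trans (u-lower (Tiling-mono r≤k T))
    (≤-reflexive (trans (cong (u P k +_) (cost-zeros 0 z)) (+-identityʳ _))))

  -- A cheapest tiling with too few dominoes must fall behind the greedy one, and there one more
  -- domino gains `μ P`.
  u-step : ∀ {k} → k < need runs → u P k + μ P ≤ u P (suc k)
  u-step {k} k<r with u-tiling k
  ... | rs , T , eq with Scan.scan-line (μ P) runs μ-≤ base T
  ... | inj₂ r≤k = contradiction (≤-trans r≤k (≤-reflexive (+-identityʳ k))) (<⇒≱ k<r)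
  ... | inj₁ G with improve T G
  ... | rs′ , T′ , gain = +-cancelʳ-≤ (cost 0 rs′) _ _ (begin
    u P k + μ P + cost 0 rs′     ≡⟨ +-assoc (u P k) (μ P) _ ⟩
    u P k + (μ P + cost 0 rs′)   ≡⟨ cong (u P k +_) (+-comm (μ P) _) ⟩
    u P k + (cost 0 rs′ + μ P)   ≤⟨ +-monoʳ-≤ (u P k) gain ⟩
    u P k + cost 0 rs            ≡⟨ eq ⟩
    n                            ≤⟨ u-lower T′ ⟩
    u P (suc k) + cost 0 rs′     ∎)
    where open ≤-Reasoning

  -- From `need runs` on, `u` is constantly `n` and the differences vanish; all earlier ones are
  -- bounded by `u-step`.
  λU-lower : ∀ k → 1 ≤ λU P (suc k) → μ P ≤ λU P (suc k)
  λU-lower k 1≤λ with k <? need runs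
  ... | yes k<r = m+n≤o⇒m≤o∸n (μ P) (≤-trans (≤-reflexive (+-comm (μ P) (u P k))) (u-step k<r))
  ... | no k≮r = contradiction 1≤λ (<⇒≱ (s≤s (≤-reflexive
    (m≤n⇒m∸n≡0 (≤-trans (u-≤ (suc k)) (≤-reflexive (sym (u-full (≮⇒≥ k≮r)))))))))

  λU-attained : 1 ≤ n → ∃[ k ] 1 ≤ k × λU P k ≡ μ P
  λU-attained 1≤n with term runs (μ-term 1≤n)
  -- The witness `suc h` is `need runs`: with `h` dominoes cost `μ P` is reached, so at most `μ P`
  -- is left to gain.
  ... | h , sh≡r , rs , T , c≡μ = suc h , s≤s z≤n , ≤-antisym upper (λU-lower h λ-positive)
    where
    open ≤-Reasoning
    upper : λU P (suc h) ≤ μ P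
    upper = m≤n+o⇒m∸n≤o _ (u P h) (begin
      u P (suc h)         ≤⟨ u-≤ (suc h) ⟩
      n                   ≤⟨ u-lower T ⟩
      u P h + cost 0 rs   ≡⟨ cong (u P h +_) c≡μ ⟩
      u P h + μ P         ∎)
    λ-positive : 1 ≤ λU P (suc h)
    λ-positive = m<n⇒0<n∸m (begin-strict
      u P h             <⟨ m<m+n (u P h) (μ-positive 1≤n) ⟩
      u P h + μ P       ≤⟨ u-step (≤-reflexive sh≡r) ⟩
      u P (suc h)       ∎)

theorem2p10 : ∀ (n : ℕ) (P : Partition) → 1 ≤ n → P ⊢ n → IsMinimum (PartOfλU P) (μ P)
theorem2p10 n P 1≤n P⊢n =
  (μ-positive P P⊢n 1≤n , λU-attained P P⊢n 1≤n) ,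
  λ { _ (_ , zero , () , _) ; _ (1≤x , suc k , _ , refl) → λU-lower P P⊢n k 1≤x }
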